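{- For all integers $k>r\ge 3$, asymptotically almost surely (i.e., with probability tending to $1$ as $n\to\infty$), $$t^{(r)}(W_k(n))\ge \Pi_{r,k}\cdot\frac{n}{k}-o(n),\qquad\text{where } \Pi_{r,k}=\prod_{j=r+1}^{k}\frac{j^r}{j^r-1}.$$
   Context: For a word $w=w_1\cdots w_n$ over a finite alphabet, $r$-twins of length $t$ are $r$ pairwise disjoint index sets $\{i^{(q)}_1<\cdots<i^{(q)}_t\}$, $q=1,\dots,r$, such that the subwords $w_{i^{(q)}_1}\cdots w_{i^{(q)}_t}$ are all identical. $t^{(r)}(w)$ is the maximum length of $r$-twins in $w$. $W_k(n)$ is a word chosen uniformly at random among all $k^n$ words of length $n$ over a $k$-letter alphabet. The statement means that there is a function $f(n)=o(n)$ such that $\Pr\big(t^{(r)}(W_k(n))\ge \Pi_{r,k}n/k-f(n)\big)\to 1$. -}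

module Defs where

open import Data.Nat as ℕ using (ℕ; zero; suc; _∸_; _^_)
open import Data.Integer using (+_)
open import Data.Rational using (ℚ; _/_; 0ℚ; 1ℚ; _*_)
open import Data.Fin using (Fin; _<_)
open import Data.Vec using (Vec; lookup)
open import Data.List using (List; map; foldr; upTo)
open import Data.Product using (Σ; _×_)
open import Relation.Binary.PropositionalEquality using (_≡_; _≢_)
open import Relation.Nullary using (¬_)

Word : ℕ → ℕ → Set
Word k n = Vec (Fin k) n

record Twins {k n : ℕ} (r t : ℕ) (w : Word k n) : Set where
  field
    idx        : Fin r → Fin t → Fin n
    increasing : ∀ q a b → a < b → idx q a < idx q b
    disjoint   : ∀ q q′ → q ≢ q′ → ∀ a b → idx q a ≢ idx q′ b
    same       : ∀ q q′ a → lookup w (idx q a) ≡ lookup w (idx q′ a)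

IsMaxTwinLength : {k n : ℕ} (r : ℕ) (w : Word k n) (t : ℕ) → Set
IsMaxTwinLength r w t = Twins r t w × (∀ s → Twins r s w → s ℕ.≤ t)

-- a/b as a rational; only used with b > 0 (value 0 when b = 0).
ratio : ℕ → ℕ → ℚ
ratio a zero    = 0ℚ
ratio a (suc b) = (+ a) / suc b

Π : ℕ → ℕ → ℚ
Π r k = foldr _*_ 1ℚ (map (λ i → let j = suc (r ℕ.+ i) in ratio (j ^ r) (j ^ r ∸ 1)) (upTo (k ∸ r)))

{-# OPTIONS --safe #-}

-- E t^(r)(W_k(n)) is superadditive in n, so a linear lower bound for the expectation, together with
-- Chebyshev's inequality over long blocks, gives the bound for almost all words.
-- For k = r the slope is 1/r: cut the word into long segments, and let twin q read, in segment i, copies of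
-- the letter i + q mod r; distinct twins always read distinct letters, and almost every letter is used.
-- For the step from k to k + 1 =: K letters, erase the new letter, take twins of the remaining word, and
-- before each letter of the twins insert as many copies of the new letter as all r twins have available there.
-- If A(n) is the total length over all Kⁿ words and B(n) the part without insertions, then deleting one copy
-- before each of the r positions gives A(n) = B(n) + A(n - r), and B is linear with slope (k / K) times
-- the old one, so the slope is multiplied by (k / K) (1 - K^(-r))⁻¹ and the product telescopes to Π_{r,k} / k.
module Submission where

-- What a new letter contributes before the i-th letter of the twins is a minimum of r run lengths,
-- and its expectation is never computed. It suffices to have the inequality
-- `B (r + n) + A n ≤ A (r + n)`: for each i, inserting one new letter before the i-th letter of
-- every twin is injective on words, because the positions depend only on the erased word, and it
-- raises the i-th minimum. Iterating the inequality reproduces the geometric series in K^(-r). For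
-- k = r the slope 1/r is only approached, up to a factor (m / (m + 1))³; passing from averages to
-- almost all words costs another such cube. The sixth power is the origin of the 6 / M in the final
-- error, and since a single f has to serve every ε, m grows with n by a diagonal choice. Averages
-- are kept as sums of natural numbers over all words, with denominators cleared and negative terms
-- moved to the other side; rational numbers enter only at the end.

module Twinning where

  open import Defs
  open import Data.Empty using (⊥-elim)
  open import Data.Fin as Fin using (Fin; zero; suc; toℕ; fromℕ<)
  import Data.Fin.Properties as Fin
  import Data.Integer as ℤ
  import Data.Integer.Properties as ℤ
  open import Data.List
    using (List; []; _∷_; _++_; _∷ʳ_; map; length; allFin; cartesianProductWith; take; drop; replicate; foldr; upTo; filter)
  open import Data.List.Membership.Propositional using (_∈_)
  open import Data.List.Membership.Propositional.Properties
    using (∈-∃++; ∈-allFin; ∈-map⁻; ∈-++⁻; ∈-++⁺ˡ; ∈-++⁺ʳ; ∈-cartesianProductWith⁺; ∈-cartesianProductWith⁻)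
  open import Data.List.Properties
    using (map-++; map-∘; length-++; length-map; length-replicate; length-tabulate; length-upTo; map-tabulate;
           map-applyUpTo; ∷-injective; take++drop≡id; ++-assoc; ++-identityʳ; upTo-∷ʳ; foldr-∷ʳ)
  open import Data.List.Relation.Unary.All as All using (All; []; _∷_)
  import Data.List.Relation.Unary.All.Properties as All
  open import Data.List.Relation.Unary.AllPairs using ([]; _∷_)
  open import Data.List.Relation.Unary.Any using (here; there)
  open import Data.List.Relation.Unary.Unique.Propositional using (Unique)
  import Data.List.Relation.Unary.Unique.Propositional.Properties as Unique
  open import Data.Maybe as Maybe using (Maybe; just; nothing; maybe)
  open import Data.Maybe.Properties using (just-injective; ≡-dec)
  open import Data.Nat as ℕ
    using (ℕ; zero; suc; pred; _+_; _*_; _∸_; _^_; _⊓_; _⊔_; _≤_; _<_; z≤n; s≤s; _<?_; _≤?_)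
  open import Data.Nat.DivMod
    using (_/_; _%_; _mod_; m≡m%n+[m/n]*n; m%n<n; %-distribˡ-+; [m+kn]%n≡m%n; m<n⇒m%n≡m; m*n/n≡m; /-monoˡ-≤)
  open import Data.Nat.Induction using (<-rec)
  open import Data.Nat.ListAction using (sum)
  open import Data.Nat.ListAction.Properties using (sum-++)
  open import Data.Nat.Properties
  open import Data.Nat.Tactic.RingSolver using (solve-∀)
  open import Data.Product using (Σ; _×_; ∃; _,_; proj₁; proj₂)
  open import Data.Rational as ℚ using (ℚ; mkℚ; 0ℚ; 1ℚ; _-_; ∣_∣)
  import Data.Rational.Properties as ℚ
  open import Data.Rational.Unnormalised using (mkℚᵘ; *≤*)
  import Data.Rational.Unnormalised.Properties as ℚᵘ
  open import Data.Sum using (inj₁; inj₂)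
  open import Data.Vec using (Vec; []; _∷_; toList; lookup)
  import Data.Vec.Properties as Vec
  open import Function using (_∘_)
  open import Relation.Binary.PropositionalEquality hiding (J)
  open import Relation.Nullary using (¬_; Dec; yes; no; ¬?)

  -- Finite sums over lists

  ∑ : {A : Set} → List A → (A → ℕ) → ℕ
  ∑ xs f = sum (map f xs)

  ∑-++ : {A : Set} (xs ys : List A) (f : A → ℕ) → ∑ (xs ++ ys) f ≡ ∑ xs f + ∑ ys f
  ∑-++ xs ys f = trans (cong sum (map-++ f xs ys)) (sum-++ (map f xs) (map f ys))

  ∑-map : {A B : Set} (g : A → B) (xs : List A) (f : B → ℕ) → ∑ (map g xs) f ≡ ∑ xs (f ∘ g)
  ∑-map g xs f = cong sum (sym (map-∘ xs))

  ∑-mono : {A : Set} (xs : List A) {f g : A → ℕ} → (∀ {x} → x ∈ xs → f x ≤ g x) → ∑ xs f ≤ ∑ xs g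
  ∑-mono []       h = z≤n
  ∑-mono (x ∷ xs) h = +-mono-≤ (h (here refl)) (∑-mono xs (h ∘ there))

  ∑-cong : {A : Set} (xs : List A) {f g : A → ℕ} → (∀ {x} → x ∈ xs → f x ≡ g x) → ∑ xs f ≡ ∑ xs g
  ∑-cong xs h = ≤-antisym (∑-mono xs (≤-reflexive ∘ h)) (∑-mono xs (≤-reflexive ∘ sym ∘ h))

  private
    interchange : ∀ a b c d → (a + b) + (c + d) ≡ (a + c) + (b + d)
    interchange = solve-∀

  ∑-+ : {A : Set} (xs : List A) (f g : A → ℕ) → ∑ xs (λ x → f x + g x) ≡ ∑ xs f + ∑ xs g
  ∑-+ []       f g = refl
  ∑-+ (x ∷ xs) f g = trans (cong (f x + g x +_) (∑-+ xs f g)) (interchange (f x) (g x) (∑ xs f) (∑ xs g))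

  ∑-*ˡ : {A : Set} (c : ℕ) (xs : List A) (f : A → ℕ) → ∑ xs (λ x → c * f x) ≡ c * ∑ xs f
  ∑-*ˡ c []       f = sym (*-zeroʳ c)
  ∑-*ˡ c (x ∷ xs) f = trans (cong (c * f x +_) (∑-*ˡ c xs f)) (sym (*-distribˡ-+ c (f x) (∑ xs f)))

  ∑-const : {A : Set} (c : ℕ) (xs : List A) → ∑ xs (λ _ → c) ≡ length xs * c
  ∑-const c []       = refl
  ∑-const c (x ∷ xs) = cong (c +_) (∑-const c xs)

  ∑-swap : {A B : Set} (xs : List A) (ys : List B) (f : A → B → ℕ) →
    ∑ xs (λ x → ∑ ys (f x)) ≡ ∑ ys (λ y → ∑ xs (λ x → f x y))
  ∑-swap []       ys f = sym (trans (∑-const 0 ys) (*-zeroʳ (length ys)))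
  ∑-swap (x ∷ xs) ys f = trans (cong (∑ ys (f x) +_) (∑-swap xs ys f)) (sym (∑-+ ys (f x) _))

  ∑-product : {A B C : Set} (g : A → B → C) (xs : List A) (ys : List B) (f : C → ℕ) →
    ∑ (cartesianProductWith g xs ys) f ≡ ∑ xs (λ x → ∑ ys (λ y → f (g x y)))
  ∑-product g []       ys f = refl
  ∑-product g (x ∷ xs) ys f = trans (∑-++ (map (g x) ys) _ f)
    (cong₂ _+_ (∑-map (g x) ys f) (∑-product g xs ys f))

  ∈⇒≤∑ : {A : Set} (xs : List A) (f : A → ℕ) {x : A} → x ∈ xs → f x ≤ ∑ xs f
  ∈⇒≤∑ (x ∷ xs) f (here refl) = m≤m+n (f x) _
  ∈⇒≤∑ (y ∷ xs) f (there p)   = ≤-trans (∈⇒≤∑ xs f p) (m≤n+m _ (f y))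

  -- Remove one occurrence of the head from `ys`; as `xs` has no repetitions, the rest of `xs` still
  -- lies in what remains.
  ∑-⊆ : {A : Set} (xs ys : List A) (f : A → ℕ) → Unique xs → (∀ {x} → x ∈ xs → x ∈ ys) → ∑ xs f ≤ ∑ ys f
  ∑-⊆ []       ys f u        xs⊆ys = z≤n
  ∑-⊆ (x ∷ xs) ys f (x∉ ∷ u) xs⊆ys with ∈-∃++ (xs⊆ys (here refl))
  ... | as , bs , refl = begin
    f x + ∑ xs f             ≤⟨ +-monoʳ-≤ (f x) (∑-⊆ xs (as ++ bs) f u sub) ⟩
    f x + ∑ (as ++ bs) f     ≡⟨ cong (f x +_) (∑-++ as bs f) ⟩
    f x + (∑ as f + ∑ bs f)  ≡⟨ swap (f x) (∑ as f) (∑ bs f) ⟩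
    ∑ as f + (f x + ∑ bs f)  ≡⟨ sym (∑-++ as (x ∷ bs) f) ⟩
    ∑ (as ++ x ∷ bs) f       ∎
    where
    open ≤-Reasoning
    swap : ∀ a b c → a + (b + c) ≡ b + (a + c)
    swap = solve-∀
    sub : ∀ {y} → y ∈ xs → y ∈ as ++ bs
    sub y∈ with ∈-++⁻ as (xs⊆ys (there y∈))
    ... | inj₁ p           = ∈-++⁺ˡ p
    ... | inj₂ (here refl) = ⊥-elim (All.lookup x∉ y∈ refl)
    ... | inj₂ (there p)   = ∈-++⁺ʳ as p

  -- Turns an injective map between words of different lengths into an inequality between their
  -- totals.
  ∑-injection : {A : Set} (g : A → A) (xs ys : List A) (f : A → ℕ) → (∀ {x y} → g x ≡ g y → x ≡ y) →
    Unique xs → (∀ {x} → x ∈ xs → g x ∈ ys) → ∑ xs (f ∘ g) ≤ ∑ ys f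
  ∑-injection g xs ys f inj u im = subst (_≤ ∑ ys f) (∑-map g xs f)
    (∑-⊆ (map g xs) ys f (Unique.map⁺ inj u) sub)
    where
    sub : ∀ {y} → y ∈ map g xs → y ∈ ys
    sub p with ∈-map⁻ g p
    ... | x , x∈ , refl = im x∈

  ∑-allFin-suc : ∀ n (f : Fin (suc n) → ℕ) → ∑ (allFin (suc n)) f ≡ f zero + ∑ (allFin n) (f ∘ suc)
  ∑-allFin-suc n f = cong (f zero +_) (trans (cong (λ xs → ∑ xs f) (sym (map-tabulate (λ i → i) suc))) (∑-map suc (allFin n) f))

  -- Sums over all words

  -- The list of all words of length n, so that ∑ (words k n) is kⁿ times the expectation over W_k(n).
  words : ∀ k → ℕ → List (List (Fin k))
  words k zero    = [] ∷ []
  words k (suc n) = cartesianProductWith _∷_ (allFin k) (words k n)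

  words-length : ∀ k n {w} → w ∈ words k n → length w ≡ n
  words-length k zero    (here refl) = refl
  words-length k (suc n) w∈ with ∈-cartesianProductWith⁻ _∷_ (allFin k) (words k n) w∈
  ... | a , v , _ , v∈ , refl = cong suc (words-length k n v∈)

  words-complete : ∀ k n (w : List (Fin k)) → length w ≡ n → w ∈ words k n
  words-complete k zero    []      refl = here refl
  words-complete k (suc n) (a ∷ w) p    =
    ∈-cartesianProductWith⁺ _∷_ (∈-allFin a) (words-complete k n w (suc-injective p))

  words-unique : ∀ k n → Unique (words k n)
  words-unique k zero    = [] ∷ []
  words-unique k (suc n) = Unique.cartesianProductWith⁺ _∷_ ∷-injective (Unique.allFin⁺ k) (words-unique k n)

  ∑-words-suc : ∀ {k} n (f : List (Fin k) → ℕ) →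
    ∑ (words k (suc n)) f ≡ ∑ (allFin k) (λ a → ∑ (words k n) (λ w → f (a ∷ w)))
  ∑-words-suc {k} n f = ∑-product _∷_ (allFin k) (words k n) f

  length-words : ∀ k n → length (words k n) ≡ k ^ n
  length-words k n = trans (sym (trans (∑-const 1 (words k n)) (*-identityʳ _))) (count n)
    where
    count : ∀ n → ∑ (words k n) (λ _ → 1) ≡ k ^ n
    count zero    = refl
    count (suc n) = begin
      ∑ (words k (suc n)) (λ _ → 1)                       ≡⟨ ∑-words-suc {k} n (λ _ → 1) ⟩
      ∑ (allFin k) (λ a → ∑ (words k n) (λ _ → 1))        ≡⟨ ∑-const _ (allFin k) ⟩
      length (allFin k) * ∑ (words k n) (λ _ → 1)         ≡⟨ cong₂ _*_ (length-tabulate {n = k} (λ i → i)) (count n) ⟩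
      k * k ^ n                                           ∎
      where open ≡-Reasoning

  ∑-words-const : ∀ k n c → ∑ (words k n) (λ _ → c) ≡ k ^ n * c
  ∑-words-const k n c = trans (∑-const c (words k n)) (cong (_* c) (length-words k n))

  ∑-words-++ : ∀ {k} m n (f : List (Fin k) → ℕ) →
    ∑ (words k (m + n)) f ≡ ∑ (words k m) (λ u → ∑ (words k n) (λ v → f (u ++ v)))
  ∑-words-++ {k} zero    n f = sym (+-identityʳ _)
  ∑-words-++ {k} (suc m) n f = begin
    ∑ (words k (suc m + n)) f                                                      ≡⟨ ∑-words-suc (m + n) f ⟩
    ∑ (allFin k) (λ a → ∑ (words k (m + n)) (λ w → f (a ∷ w)))                      ≡⟨ ∑-cong (allFin k) (λ _ → ∑-words-++ m n _) ⟩
    ∑ (allFin k) (λ a → ∑ (words k m) (λ u → ∑ (words k n) (λ v → f (a ∷ u ++ v)))) ≡⟨ sym (∑-words-suc m (λ u → ∑ (words k n) (λ v → f (u ++ v)))) ⟩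
    ∑ (words k (suc m)) (λ u → ∑ (words k n) (λ v → f (u ++ v)))                    ∎
    where open ≡-Reasoning

  take-++-length : {A : Set} (u v : List A) → take (length u) (u ++ v) ≡ u
  take-++-length []      v = refl
  take-++-length (x ∷ u) v = cong (x ∷_) (take-++-length u v)

  drop-++-length : {A : Set} (u v : List A) → drop (length u) (u ++ v) ≡ v
  drop-++-length []      v = refl
  drop-++-length (x ∷ u) v = drop-++-length u v

  -- Independence: the prefix and the suffix of a uniform word are independent uniform words.
  ∑-words-split : ∀ {k} m n (f : List (Fin k) → List (Fin k) → ℕ) →
    ∑ (words k (m + n)) (λ w → f (take m w) (drop m w)) ≡ ∑ (words k m) (λ u → ∑ (words k n) (f u))
  ∑-words-split {k} m n f = trans (∑-words-++ m n _)
    (∑-cong (words k m) (λ {u} u∈ → ∑-cong (words k n) (λ {v} _ → at u v (words-length k m u∈))))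
    where
    at : ∀ u v → length u ≡ m → f (take m (u ++ v)) (drop m (u ++ v)) ≡ f u v
    at u v refl = cong₂ f (take-++-length u v) (drop-++-length u v)

  -- Block sums, their moments and the weak law

  ind : {P : Set} → Dec P → ℕ
  ind (yes _) = 1
  ind (no _)  = 0

  blockSum : {A : Set} → ℕ → (List A → ℕ) → ℕ → List A → ℕ
  blockSum L X zero    w = 0
  blockSum L X (suc M) w = X (take L w) + blockSum L X M (drop L w)

  -- On a uniform word the `M` block values are independent with mean `T / N` and second moment
  -- `U / N`; `ρ` is the length of the tail that no block reads.
  module Moments (k L ρ : ℕ) (X : List (Fin k) → ℕ) where

    T U N : ℕ
    T = ∑ (words k L) X
    U = ∑ (words k L) (λ u → X u * X u)
    N = k ^ L

    size : ℕ → ℕ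
    size M = k ^ (M * L + ρ)

    Z : ℕ → List (Fin k) → ℕ
    Z = blockSum L X

    E₁ E₂ : ℕ → ℕ
    E₁ M = ∑ (words k (M * L + ρ)) (Z M)
    E₂ M = ∑ (words k (M * L + ρ)) (λ w → Z M w * Z M w)

    size-suc : ∀ M → size (suc M) ≡ N * size M
    size-suc M = trans (cong (k ^_) (+-assoc L (M * L) ρ)) (^-distribˡ-+-* k L (M * L + ρ))

    split-suc : ∀ M (f : List (Fin k) → List (Fin k) → ℕ) →
      ∑ (words k (suc M * L + ρ)) (λ w → f (take L w) (drop L w)) ≡
      ∑ (words k L) (λ u → ∑ (words k (M * L + ρ)) (f u))
    split-suc M f = trans (cong (λ n → ∑ (words k n) (λ w → f (take L w) (drop L w))) (+-assoc L (M * L) ρ)) (∑-words-split L (M * L + ρ) f)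

    E₁-suc : ∀ M → E₁ (suc M) ≡ size M * T + N * E₁ M
    E₁-suc M = begin
      E₁ (suc M)
        ≡⟨ split-suc M (λ u v → X u + Z M v) ⟩
      ∑ (words k L) (λ u → ∑ (words k (M * L + ρ)) (λ v → X u + Z M v))
        ≡⟨ ∑-cong (words k L) (λ {u} _ → trans (∑-+ (words k (M * L + ρ)) _ (Z M)) (cong (_+ E₁ M) (∑-words-const k (M * L + ρ) (X u)))) ⟩
      ∑ (words k L) (λ u → size M * X u + E₁ M)
        ≡⟨ ∑-+ (words k L) _ _ ⟩
      ∑ (words k L) (λ u → size M * X u) + ∑ (words k L) (λ u → E₁ M)
        ≡⟨ cong₂ _+_ (∑-*ˡ (size M) (words k L) X) (∑-words-const k L (E₁ M)) ⟩
      size M * T + N * E₁ M ∎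
      where open ≡-Reasoning

    E₁-closed : ∀ M → N * E₁ M ≡ M * T * size M
    E₁-closed zero    = trans (cong (N *_) (trans (∑-words-const k ρ 0) (*-zeroʳ (k ^ ρ)))) (*-zeroʳ N)
    E₁-closed (suc M) = begin
      N * E₁ (suc M)                        ≡⟨ cong (N *_) (E₁-suc M) ⟩
      N * (size M * T + N * E₁ M)           ≡⟨ cong (λ e → N * (size M * T + e)) (E₁-closed M) ⟩
      N * (size M * T + M * T * size M)     ≡⟨ alg N (size M) T M ⟩
      suc M * T * (N * size M)              ≡⟨ cong (suc M * T *_) (sym (size-suc M)) ⟩
      suc M * T * size (suc M)              ∎
      where
      open ≡-Reasoning
      alg : ∀ N s T M → N * (s * T + M * T * s) ≡ (1 + M) * T * (N * s)
      alg = solve-∀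

    E₂-suc : ∀ M → E₂ (suc M) ≡ size M * U + 2 * E₁ M * T + N * E₂ M
    E₂-suc M = begin
      E₂ (suc M)
        ≡⟨ split-suc M (λ u v → (X u + Z M v) * (X u + Z M v)) ⟩
      ∑ (words k L) (λ u → ∑ ws (λ v → (X u + Z M v) * (X u + Z M v)))
        ≡⟨ ∑-cong (words k L) (λ {u} _ → inner (X u)) ⟩
      ∑ (words k L) (λ u → size M * (X u * X u) + 2 * E₁ M * X u + E₂ M)
        ≡⟨ ∑-+ (words k L) _ _ ⟩
      ∑ (words k L) (λ u → size M * (X u * X u) + 2 * E₁ M * X u) + ∑ (words k L) (λ u → E₂ M)
        ≡⟨ cong₂ _+_ (trans (∑-+ (words k L) _ _) (cong₂ _+_ (∑-*ˡ (size M) (words k L) _) (∑-*ˡ (2 * E₁ M) (words k L) X)))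
                     (∑-words-const k L (E₂ M)) ⟩
      size M * U + 2 * E₁ M * T + N * E₂ M ∎
      where
      open ≡-Reasoning
      ws = words k (M * L + ρ)
      square : ∀ x z → (x + z) * (x + z) ≡ (x * x + 2 * x * z) + z * z
      square = solve-∀
      comm : ∀ x e → 2 * x * e ≡ 2 * e * x
      comm = solve-∀
      inner : ∀ x → ∑ ws (λ v → (x + Z M v) * (x + Z M v)) ≡ size M * (x * x) + 2 * E₁ M * x + E₂ M
      inner x = begin
        ∑ ws (λ v → (x + Z M v) * (x + Z M v))
          ≡⟨ ∑-cong ws (λ {v} _ → square x (Z M v)) ⟩
        ∑ ws (λ v → (x * x + 2 * x * Z M v) + Z M v * Z M v)
          ≡⟨ ∑-+ ws _ _ ⟩
        ∑ ws (λ v → x * x + 2 * x * Z M v) + E₂ M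
          ≡⟨ cong (_+ E₂ M) (∑-+ ws _ _) ⟩
        ∑ ws (λ v → x * x) + ∑ ws (λ v → 2 * x * Z M v) + E₂ M
          ≡⟨ cong (_+ E₂ M) (cong₂ _+_ (∑-words-const k (M * L + ρ) (x * x)) (trans (∑-*ˡ (2 * x) ws (Z M)) (comm x (E₁ M)))) ⟩
        size M * (x * x) + 2 * E₁ M * x + E₂ M ∎

    -- The variance of `M` independent blocks is `M (U / N - (T / N)²)`; here it is multiplied by
    -- `N * N * size M`, with the negative term on the left.
    E₂-closed : ∀ M → N * N * E₂ M + M * (T * T) * size M ≡ (M * N * U + M * T * (M * T)) * size M
    E₂-closed zero    = trans (+-identityʳ _) (trans (cong (N * N *_) (trans (∑-words-const k ρ 0) (*-zeroʳ (k ^ ρ)))) (*-zeroʳ (N * N)))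
    E₂-closed (suc M) = begin
      N * N * E₂ (suc M) + suc M * (T * T) * size (suc M)
        ≡⟨ cong₂ (λ e s → N * N * e + suc M * (T * T) * s) (E₂-suc M) (size-suc M) ⟩
      N * N * (size M * U + 2 * E₁ M * T + N * E₂ M) + suc M * (T * T) * (N * size M)
        ≡⟨ alg₁ N (size M) U (E₁ M) T (E₂ M) M ⟩
      N * N * size M * U + 2 * N * T * (N * E₁ M) + N * (N * N * E₂ M + M * (T * T) * size M) + T * T * (N * size M)
        ≡⟨ cong₂ (λ a b → N * N * size M * U + 2 * N * T * a + N * b + T * T * (N * size M)) (E₁-closed M) (E₂-closed M) ⟩
      N * N * size M * U + 2 * N * T * (M * T * size M) + N * ((M * N * U + M * T * (M * T)) * size M) + T * T * (N * size M)
        ≡⟨ alg₂ N (size M) U T M ⟩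
      (suc M * N * U + suc M * T * (suc M * T)) * (N * size M)
        ≡⟨ cong ((suc M * N * U + suc M * T * (suc M * T)) *_) (sym (size-suc M)) ⟩
      (suc M * N * U + suc M * T * (suc M * T)) * size (suc M) ∎
      where
      open ≡-Reasoning
      alg₁ : ∀ N s U e T f M → N * N * (s * U + 2 * e * T + N * f) + (1 + M) * (T * T) * (N * s)
           ≡ N * N * s * U + 2 * N * T * (N * e) + N * (N * N * f + M * (T * T) * s) + T * T * (N * s)
      alg₁ = solve-∀
      alg₂ : ∀ N s U T M → N * N * s * U + 2 * N * T * (M * T * s) + N * ((M * N * U + M * T * (M * T)) * s) + T * T * (N * s)
           ≡ ((1 + M) * N * U + (1 + M) * T * ((1 + M) * T)) * (N * s)
      alg₂ = solve-∀

  2cx≤c²+x² : ∀ c x → 2 * (c * x) ≤ c * c + x * x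
  2cx≤c²+x² c x with ≤-total c x
  ... | inj₁ c≤x = subst (λ y → 2 * (c * y) ≤ c * c + y * y) (m+[n∸m]≡n c≤x)
    (subst (2 * (c * (c + (x ∸ c))) ≤_) (alg c (x ∸ c)) (m≤m+n _ _))
    where
    alg : ∀ c d → 2 * (c * (c + d)) + d * d ≡ c * c + (c + d) * (c + d)
    alg = solve-∀
  ... | inj₂ x≤c = subst (λ y → 2 * (y * x) ≤ y * y + x * x) (m+[n∸m]≡n x≤c)
    (subst (2 * ((x + (c ∸ x)) * x) ≤_) (alg x (c ∸ x)) (m≤m+n _ _))
    where
    alg : ∀ x d → 2 * ((x + d) * x) + d * d ≡ (x + d) * (x + d) + x * x
    alg = solve-∀

  -- Chebyshev's inequality b c² ≤ m² (c - x)², with both sides moved so that no subtraction occurs.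
  chebyshev : ∀ m c x → ind (suc m * x <? m * c) * (c * c) + 2 * (suc m * suc m) * c * x ≤ suc m * suc m * (c * c + x * x)
  chebyshev m c x with suc m * x <? m * c
  ... | no _  = subst (_≤ suc m * suc m * (c * c + x * x)) (alg (suc m * suc m) c x) (*-monoʳ-≤ (suc m * suc m) (2cx≤c²+x² c x))
    where
    alg : ∀ m c x → m * (2 * (c * x)) ≡ 2 * m * c * x
    alg = solve-∀
  ... | yes mx<mc = subst (λ c → c * c + 0 + 2 * (suc m * suc m) * c * x ≤ suc m * suc m * (c * c + x * x)) x+d≡c
    (begin
      (x + d) * (x + d) + 0 + 2 * (suc m * suc m) * (x + d) * x
        ≤⟨ +-monoˡ-≤ _ (≤-trans (≤-reflexive (+-identityʳ _)) (*-mono-≤ x+d≤md x+d≤md)) ⟩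
      suc m * d * (suc m * d) + 2 * (suc m * suc m) * (x + d) * x
        ≡⟨ alg (suc m) x d ⟩
      suc m * suc m * ((x + d) * (x + d) + x * x) ∎)
    where
    open ≤-Reasoning
    d = c ∸ x
    x≤c : x ≤ c
    x≤c = *-cancelˡ-≤ (suc m) (≤-trans (<⇒≤ mx<mc) (m≤n+m (m * c) c))
    x+d≡c : x + d ≡ c
    x+d≡c = m+[n∸m]≡n x≤c
    -- A value below m / (m + 1) of the mean `c` misses it by at least `c / (m + 1)`.
    x+d≤md : x + d ≤ suc m * d
    x+d≤md = +-cancelʳ-≤ (suc m * x) (x + d) (suc m * d) (begin
      x + d + suc m * x        ≡⟨ cong (_+ suc m * x) x+d≡c ⟩
      c + suc m * x            ≤⟨ +-monoʳ-≤ c (<⇒≤ mx<mc) ⟩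
      suc m * c                ≡⟨ cong (suc m *_) (trans (sym x+d≡c) (+-comm x d)) ⟩
      suc m * (d + x)          ≡⟨ *-distribˡ-+ (suc m) d x ⟩
      suc m * d + suc m * x    ∎)
    alg : ∀ m x d → m * d * (m * d) + 2 * (m * m) * (x + d) * x ≡ m * m * ((x + d) * (x + d) + x * x)
    alg = solve-∀

  -- Sum `chebyshev` over all words: the variance is linear in `M` and the squared mean quadratic,
  -- so the share of words below m / (m + 1) of the mean is O(1 / M).
  weakLaw : ∀ k L ρ (X : List (Fin k) → ℕ) (m e : ℕ) → 1 ≤ ∑ (words k L) X →
    ∃ λ M₀ → ∀ M → M₀ ≤ M →
      e * ∑ (words k (M * L + ρ)) (λ w → ind (suc m * (k ^ L * blockSum L X M w) <? m * (M * ∑ (words k L) X)))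
        ≤ k ^ (M * L + ρ)
  -- `few` bounds the share of bad words by `q / M`, so more than `e * q` blocks are enough. This
  -- threshold involves `N` and `U` but not `ρ`, and `typical` relies on that.
  weakLaw k L ρ X m e 1≤T = suc (e * q) , bound
    where
    open Moments k L ρ X
    open ≤-Reasoning
    m² = suc m * suc m
    q = m² * N * U
    module _ (M : ℕ) where
      c = M * T
      ws = words k (M * L + ρ)
      b : List (Fin k) → ℕ
      b w = ind (suc m * (N * Z M w) <? m * c)
      B = ∑ ws b
      summed : B * (c * c) + 2 * m² * c * (N * E₁ M) ≤ m² * (c * c * size M + N * N * E₂ M)
      summed = begin
        B * (c * c) + 2 * m² * c * (N * E₁ M)
          ≡⟨ cong₂ _+_ (trans (*-comm B (c * c)) (sym (∑-*ˡ (c * c) ws b)))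
                       (trans (sym (*-assoc (2 * m² * c) N (E₁ M))) (sym (∑-*ˡ (2 * m² * c * N) ws (Z M)))) ⟩
        ∑ ws (λ w → c * c * b w) + ∑ ws (λ w → 2 * m² * c * N * Z M w)
          ≡⟨ sym (∑-+ ws _ _) ⟩
        ∑ ws (λ w → c * c * b w + 2 * m² * c * N * Z M w)
          ≤⟨ ∑-mono ws (λ {w} _ → subst₂ _≤_
               (cong₂ _+_ (*-comm (b w) (c * c)) (sym (*-assoc (2 * m² * c) N (Z M w))))
               (alg m² c N (Z M w)) (chebyshev m c (N * Z M w))) ⟩
        ∑ ws (λ w → m² * (c * c) + m² * (N * N) * (Z M w * Z M w))
          ≡⟨ ∑-+ ws _ _ ⟩
        ∑ ws (λ w → m² * (c * c)) + ∑ ws (λ w → m² * (N * N) * (Z M w * Z M w))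
          ≡⟨ cong₂ _+_ (∑-words-const k (M * L + ρ) (m² * (c * c))) (∑-*ˡ (m² * (N * N)) ws _) ⟩
        size M * (m² * (c * c)) + m² * (N * N) * E₂ M
          ≡⟨ alg′ (size M) m² (c * c) (N * N) (E₂ M) ⟩
        m² * (c * c * size M + N * N * E₂ M) ∎
        where
        alg : ∀ m² c N z → m² * (c * c + N * z * (N * z)) ≡ m² * (c * c) + m² * (N * N) * (z * z)
        alg = solve-∀
        alg′ : ∀ s m² cc NN e → s * (m² * cc) + m² * NN * e ≡ m² * (cc * s + NN * e)
        alg′ = solve-∀
      -- `E₂-closed` makes the squared mean cancel; of the scaled variance `M (N U - T²)` only
      -- `M N U` is kept.
      variance : B * (c * c) ≤ m² * (M * N * U) * size M
      variance = +-cancelʳ-≤ (2 * m² * c * (c * size M) + m² * (M * (T * T) * size M)) _ _ (begin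
        B * (c * c) + (2 * m² * c * (c * size M) + m² * (M * (T * T) * size M))
          ≡⟨ sym (+-assoc (B * (c * c)) _ _) ⟩
        B * (c * c) + 2 * m² * c * (c * size M) + m² * (M * (T * T) * size M)
          ≡⟨ cong (λ a → B * (c * c) + 2 * m² * c * a + m² * (M * (T * T) * size M)) (sym (E₁-closed M)) ⟩
        B * (c * c) + 2 * m² * c * (N * E₁ M) + m² * (M * (T * T) * size M)
          ≤⟨ +-monoˡ-≤ _ summed ⟩
        m² * (c * c * size M + N * N * E₂ M) + m² * (M * (T * T) * size M)
          ≡⟨ alg₁ m² (c * c * size M) (N * N * E₂ M) (M * (T * T) * size M) ⟩
        m² * (c * c * size M) + m² * (N * N * E₂ M + M * (T * T) * size M)
          ≡⟨ cong (λ a → m² * (c * c * size M) + m² * a) (E₂-closed M) ⟩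
        m² * (c * c * size M) + m² * ((M * N * U + c * c) * size M)
          ≡⟨ alg₂ m² c (size M) (M * N * U) ⟩
        m² * (M * N * U) * size M + 2 * m² * c * (c * size M)
          ≤⟨ +-monoʳ-≤ (m² * (M * N * U) * size M) (m≤m+n _ _) ⟩
        m² * (M * N * U) * size M + (2 * m² * c * (c * size M) + m² * (M * (T * T) * size M)) ∎)
        where
        alg₁ : ∀ m a b d → m * (a + b) + m * d ≡ m * a + m * (b + d)
        alg₁ = solve-∀
        alg₂ : ∀ m c s v → m * (c * c * s) + m * ((v + c * c) * s) ≡ m * v * s + 2 * m * c * (c * s)
        alg₂ = solve-∀
      few : 1 ≤ M → M * B ≤ q * size M
      few (s≤s {n = M′} z≤n) = *-cancelˡ-≤ M (begin
        M * (M * B)                  ≤⟨ *-monoʳ-≤ M (*-monoʳ-≤ M (m≤m*n B (T * T))) ⟩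
        M * (M * (B * (T * T)))      ≡⟨ alg₁ M B T ⟩
        B * (c * c)                  ≤⟨ variance ⟩
        m² * (M * N * U) * size M    ≡⟨ alg₂ m² M N U (size M) ⟩
        M * (q * size M)             ∎)
        where
        instance
          _ : ℕ.NonZero T
          _ = ℕ.>-nonZero 1≤T
          _ : ℕ.NonZero (T * T)
          _ = m*n≢0 T T
        alg₁ : ∀ M B T → M * (M * (B * (T * T))) ≡ B * (M * T * (M * T))
        alg₁ = solve-∀
        alg₂ : ∀ m M N U s → m * (M * N * U) * s ≡ M * (m * N * U * s)
        alg₂ = solve-∀
      fewer : ∀ q′ → suc (e * q′) ≤ M → M * B ≤ q′ * size M → e * B ≤ size M
      fewer zero    eq<M p = ≤-trans (≤-reflexive (trans (cong (e *_) (n≤0⇒n≡0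
        (≤-trans (m≤n*m B M ⦃ ℕ.>-nonZero (≤-trans (s≤s z≤n) eq<M) ⦄) p))) (*-zeroʳ e))) z≤n
      fewer (suc q′) eq<M p = *-cancelˡ-≤ (suc q′) (begin
        suc q′ * (e * B)   ≡⟨ alg (suc q′) e B ⟩
        e * suc q′ * B     ≤⟨ *-monoˡ-≤ B (<⇒≤ eq<M) ⟩
        M * B              ≤⟨ p ⟩
        suc q′ * size M    ∎)
        where
        alg : ∀ q e B → q * (e * B) ≡ e * q * B
        alg = solve-∀
    bound : ∀ M → suc (e * q) ≤ M → e * B M ≤ size M
    bound M h = fewer M q h (few M (≤-trans (s≤s z≤n) h))

  -- Colourings, twins and densities

  -- A family of r disjoint subwords is encoded by colouring some letters with colours in Fin r.
  Coloured : ℕ → ℕ → Set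
  Coloured r k = List (Fin k × Maybe (Fin r))

  consIf : {P A : Set} → Dec P → A → List A → List A
  consIf (yes _) a u = a ∷ u
  consIf (no _)  a u = u

  read : ∀ {r k} → Fin r → Coloured r k → List (Fin k)
  read q []                 = []
  read q ((a , nothing) ∷ c) = read q c
  read q ((a , just p) ∷ c)  = consIf (p Fin.≟ q) a (read q c)

  consIf-++ : {P A : Set} (d : Dec P) (a : A) (u v : List A) → consIf d a (u ++ v) ≡ consIf d a u ++ v
  consIf-++ (yes _) a u v = refl
  consIf-++ (no _)  a u v = refl

  read-++ : ∀ {r k} (q : Fin r) (c d : Coloured r k) → read q (c ++ d) ≡ read q c ++ read q d
  read-++ q []                  d = refl
  read-++ q ((a , nothing) ∷ c) d = read-++ q c d
  read-++ q ((a , just p) ∷ c)  d =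
    trans (cong (consIf (p Fin.≟ q) a) (read-++ q c d)) (consIf-++ (p Fin.≟ q) a (read q c) (read q d))

  -- Colour classes are disjoint and are read in word order, so only the equality of the r readings
  -- is left to demand. `t` is a mere lower bound for their length, which lets estimates be used as
  -- lengths.
  HasTwins : ∀ {k} → ℕ → List (Fin k) → ℕ → Set
  HasTwins {k} r w t =
    Σ (Coloured r k) λ c → map proj₁ c ≡ w × Σ (List (Fin k)) λ u → t ≤ length u × (∀ q → read q c ≡ u)

  uncoloured : ∀ {k} r → List (Fin k) → Coloured r k
  uncoloured r = map (_, nothing)

  read-uncoloured : ∀ {r k} (q : Fin r) (w : List (Fin k)) → read q (uncoloured r w) ≡ []
  read-uncoloured q []      = refl
  read-uncoloured q (a ∷ w) = read-uncoloured q w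

  word-uncoloured : ∀ {r k} (w : List (Fin k)) → map proj₁ (uncoloured r w) ≡ w
  word-uncoloured []      = refl
  word-uncoloured (a ∷ w) = cong (a ∷_) (word-uncoloured w)

  hasTwins-0 : ∀ {r k} (w : List (Fin k)) → HasTwins r w 0
  hasTwins-0 {r} w = uncoloured r w , word-uncoloured w , [] , z≤n , λ q → read-uncoloured q w

  -- Superadditivity: concatenating two colourings concatenates each reading.
  hasTwins-++ : ∀ {r k s t} (u v : List (Fin k)) → HasTwins r u s → HasTwins r v t → HasTwins r (u ++ v) (s + t)
  hasTwins-++ u v (c , wc , x , s≤ , rc) (d , wd , y , t≤ , rd) =
    c ++ d , trans (map-++ proj₁ c d) (cong₂ _++_ wc wd) , x ++ y ,
    ≤-trans (+-mono-≤ s≤ t≤) (≤-reflexive (sym (length-++ x))) ,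
    λ q → trans (read-++ q c d) (cong₂ _++_ (rc q) (rd q))

  hasTwins-blockSum : ∀ {r k} L {X : List (Fin k) → ℕ} → (∀ w → HasTwins r w (X w)) →
    ∀ M w → HasTwins r w (blockSum L X M w)
  hasTwins-blockSum     L h zero    w = hasTwins-0 w
  hasTwins-blockSum {r} L {X} h (suc M) w = subst (λ v → HasTwins r v (X (take L w) + blockSum L X M (drop L w)))
    (take++drop≡id L w) (hasTwins-++ (take L w) (drop L w) (h (take L w)) (hasTwins-blockSum L h M (drop L w)))

  -- E t^(r)(W_k(n)) ≥ (P / Q) n - D / Q, with denominators cleared.
  Density : ℕ → ℕ → ℕ → ℕ → Set
  Density r k P Q = Σ (List (Fin k) → ℕ) λ X → (∀ w → HasTwins r w (X w)) ×
    ∃ λ D → ∀ n → P * n * k ^ n ≤ Q * ∑ (words k n) X + D * k ^ n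

  -- Fekete: by superadditivity one good block length yields the density at all lengths.
  density-from-block : ∀ {r k} P Q L (X : List (Fin (suc k)) → ℕ) → (∀ w → HasTwins r w (X w)) →
    P * suc L * suc k ^ suc L ≤ Q * ∑ (words (suc k) (suc L)) X → Density r (suc k) P Q
  -- The constant `P * L` pays for the fewer than `L` letters after the last full block. `Density`
  -- asks for one function on words of all lengths, so the number of blocks is recovered from
  -- `length w`.
  density-from-block {r} {k′} P Q L′ X twins block = Y , (λ w → hasTwins-blockSum L twins (length w / L) w) , P * L , bound
    where
    k = suc k′
    L = suc L′
    Y : List (Fin k) → ℕ
    Y w = blockSum L X (length w / L) w
    bound : ∀ n → P * n * k ^ n ≤ Q * ∑ (words k n) Y + P * L * k ^ n
    bound n = subst (λ n → P * n * k ^ n ≤ Q * ∑ (words k n) Y + P * L * k ^ n) (sym n≡)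
      (≤-trans (*-cancelˡ-≤ N ⦃ m^n≢0 k L ⦄ scaled) (≤-reflexive (cong (λ s → Q * s + P * L * K)
        (∑-cong (words k (M * L + ρ)) (λ {w} w∈ → cong (λ l → blockSum L X (l / L) w)
          (trans n≡ (sym (words-length k (M * L + ρ) w∈))))))))
      where
      M = n / L
      ρ = n % L
      open Moments k L ρ X
      n≡ : n ≡ M * L + ρ
      n≡ = trans (m≡m%n+[m/n]*n n L) (+-comm ρ (M * L))
      K = size M
      open ≤-Reasoning
      scaled : N * (P * (M * L + ρ) * K) ≤ N * (Q * E₁ M + P * L * K)
      scaled = begin
        N * (P * (M * L + ρ) * K)           ≤⟨ *-monoʳ-≤ N (*-monoˡ-≤ K (*-monoʳ-≤ P (+-monoʳ-≤ (M * L) (<⇒≤ (m%n<n n L))))) ⟩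
        N * (P * (M * L + L) * K)           ≡⟨ alg₁ N P M L K ⟩
        M * K * (P * L * N) + N * (P * L * K) ≤⟨ +-monoˡ-≤ _ (*-monoʳ-≤ (M * K) block) ⟩
        M * K * (Q * T) + N * (P * L * K)   ≡⟨ cong (_+ N * (P * L * K)) (alg₂ M K Q T) ⟩
        Q * (M * T * K) + N * (P * L * K)   ≡⟨ cong (λ e → Q * e + N * (P * L * K)) (sym (E₁-closed M)) ⟩
        Q * (N * E₁ M) + N * (P * L * K)    ≡⟨ alg₃ Q N (E₁ M) (P * L * K) ⟩
        N * (Q * E₁ M + P * L * K)          ∎
        where
        alg₁ : ∀ N P M L K → N * (P * (M * L + L) * K) ≡ M * K * (P * L * N) + N * (P * L * K)
        alg₁ = solve-∀
        alg₂ : ∀ M K Q T → M * K * (Q * T) ≡ Q * (M * T * K)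
        alg₂ = solve-∀
        alg₃ : ∀ Q N E R → Q * (N * E) + N * R ≡ N * (Q * E + R)
        alg₃ = solve-∀

  -- The base case k = r

  ind-mono : {P Q : Set} → (P → Q) → (p : Dec P) (q : Dec Q) → ind p ≤ ind q
  ind-mono f (yes p) (yes q) = ≤-refl
  ind-mono f (yes p) (no ¬q) = ⊥-elim (¬q (f p))
  ind-mono f (no _)  q       = z≤n

  count : ∀ {k} → Fin k → List (Fin k) → ℕ
  count a []      = 0
  count a (x ∷ w) = ind (a Fin.≟ x) + count a w

  -- Colours the first n a occurrences of each letter a with g a.
  colourFirst : ∀ {r k} → (Fin k → Maybe (Fin r)) → (Fin k → ℕ) → List (Fin k) → Coloured r k
  spend : ∀ {k} → (Fin k → ℕ) → Fin k → Fin k → ℕ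
  spend n x a with a Fin.≟ x
  ... | yes _ = pred (n a)
  ... | no _  = n a
  activeColour : ∀ {r} → ℕ → Maybe (Fin r) → Maybe (Fin r)
  activeColour zero    p = nothing
  activeColour (suc _) p = p
  colourFirst g n []      = []
  colourFirst g n (x ∷ w) = (x , activeColour (n x) (g x)) ∷ colourFirst g (spend n x) w

  word-colourFirst : ∀ {r k} (g : Fin k → Maybe (Fin r)) n w → map proj₁ (colourFirst g n w) ≡ w
  word-colourFirst g n []      = refl
  word-colourFirst g n (x ∷ w) = cong (x ∷_) (word-colourFirst g (spend n x) w)

  read-colourFirst-unused : ∀ {r k} (g : Fin k → Maybe (Fin r)) n w q → (∀ a → g a ≢ just q) →
    read q (colourFirst g n w) ≡ []
  read-colourFirst-unused g n []      q unused = refl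
  read-colourFirst-unused g n (x ∷ w) q unused with n x | g x in gx | read-colourFirst-unused g (spend n x) w q unused
  ... | zero  | _       | ih = ih
  ... | suc _ | nothing | ih = ih
  ... | suc _ | just p  | ih with p Fin.≟ q
  ...   | yes refl = ⊥-elim (unused x gx)
  ...   | no _     = ih

  -- Only the letter `a` carries the colour `q`, so the reading consists of copies of `a`, and the
  -- word has enough of them to spend all `n a`.
  read-colourFirst : ∀ {r k} (g : Fin k → Maybe (Fin r)) n w q a → g a ≡ just q → (∀ b → g b ≡ just q → b ≡ a) →
    n a ≤ count a w → read q (colourFirst g n w) ≡ replicate (n a) a
  read-colourFirst g n []      q a ga inj n≤ rewrite n≤0⇒n≡0 n≤ = refl
  read-colourFirst g n (x ∷ w) q a ga inj n≤
    with a Fin.≟ x | (λ h → read-colourFirst g (spend n x) w q a ga inj h)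
  ... | yes refl | ih with a Fin.≟ a
  ...   | no a≢a = ⊥-elim (a≢a refl)
  ...   | yes _ with n a
  ...     | zero  = ih z≤n
  ...     | suc m rewrite ga with q Fin.≟ q
  ...       | yes _  = cong (a ∷_) (ih (≤-pred n≤))
  ...       | no q≢q = ⊥-elim (q≢q refl)
  read-colourFirst g n (x ∷ w) q a ga inj n≤ | no a≢x | ih with a Fin.≟ x
  ... | yes a≡x = ⊥-elim (a≢x a≡x)
  ... | no _ with n x | g x in gx
  ...   | zero  | _       = ih n≤
  ...   | suc _ | nothing = ih n≤
  ...   | suc _ | just p with p Fin.≟ q
  ...     | yes refl = ⊥-elim (a≢x (sym (inj x gx)))
  ...     | no _     = ih n≤

  reverseLookup : ∀ {r k} → (Fin r → Maybe (Fin k)) → Fin k → Maybe (Fin r)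
  reverseLookup f a with Fin.any? (λ q → ≡-dec Fin._≟_ (f q) (just a))
  ... | yes (q , _) = just q
  ... | no _        = nothing

  reverseLookup-sound : ∀ {r k} (f : Fin r → Maybe (Fin k)) a q → reverseLookup f a ≡ just q → f q ≡ just a
  reverseLookup-sound f a q eq with Fin.any? (λ q → ≡-dec Fin._≟_ (f q) (just a))
  reverseLookup-sound f a q refl | yes (_ , fq) = fq

  reverseLookup-complete : ∀ {r k} (f : Fin r → Maybe (Fin k)) a q → (∀ p → f p ≡ just a → p ≡ q) →
    f q ≡ just a → reverseLookup f a ≡ just q
  reverseLookup-complete f a q inj fq with Fin.any? (λ q → ≡-dec Fin._≟_ (f q) (just a))
  ... | yes (p , fp) = cong just (inj p fp)
  ... | no ¬p        = ⊥-elim (¬p (q , fq))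

  distribute : ∀ {r k} → (Fin r → Maybe (Fin k)) → ℕ → List (Fin k) → Coloured r k
  distribute f s = colourFirst (reverseLookup f) (λ _ → s)

  read-distribute : ∀ {r k} (f : Fin r → Maybe (Fin k)) s w →
    (∀ p q a → f p ≡ just a → f q ≡ just a → p ≡ q) → (∀ a → s ≤ count a w) →
    ∀ q → read q (distribute f s w) ≡ maybe (replicate s) [] (f q)
  read-distribute f s w inj enough q with f q in fq
  ... | nothing = read-colourFirst-unused (reverseLookup f) (λ _ → s) w q unused
    where
    unused : ∀ a → reverseLookup f a ≢ just q
    unused a eq with trans (sym fq) (reverseLookup-sound f a q eq)
    ... | ()
  ... | just a = read-colourFirst (reverseLookup f) (λ _ → s) w q a
    (reverseLookup-complete f a q (λ p fp → inj p q a fp fq) fq)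
    (λ b eq → just-injective (trans (sym (reverseLookup-sound f b q eq)) fq)) (enough a)

  -- Modulo r + 1 the number `i * r` acts as the inverse of `i`; adding it to `i + p` recovers `p`.
  mod-shift-injective : ∀ r i (p q : Fin (suc r)) → (i + toℕ p) % suc r ≡ (i + toℕ q) % suc r → p ≡ q
  mod-shift-injective r i p q eq = Fin.toℕ-injective (trans (sym (recover p)) (trans (cong (λ x → (i * r % suc r + x) % suc r) eq) (recover q)))
    where
    recover : ∀ (p : Fin (suc r)) → (i * r % suc r + (i + toℕ p) % suc r) % suc r ≡ toℕ p
    recover p = begin
      (i * r % suc r + (i + toℕ p) % suc r) % suc r ≡⟨ sym (%-distribˡ-+ (i * r) (i + toℕ p) (suc r)) ⟩
      (i * r + (i + toℕ p)) % suc r                 ≡⟨ cong (_% suc r) (alg i r (toℕ p)) ⟩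
      (toℕ p + i * suc r) % suc r                   ≡⟨ [m+kn]%n≡m%n (toℕ p) i (suc r) ⟩
      toℕ p % suc r                                 ≡⟨ m<n⇒m%n≡m (Fin.toℕ<n p) ⟩
      toℕ p                                         ∎
      where
      open ≡-Reasoning
      alg : ∀ i r p → i * r + (i + p) ≡ p + i * (1 + r)
      alg = solve-∀

  -- In segment i twin q reads s copies of the letter of phase i + q, so distinct twins always read distinct letters.
  -- Restricting to the phases from r₀ to M - 1, which all twins meet, makes the r readings equal.
  module Rotation (r₀ s ℓ M : ℕ) where
    r = suc r₀

    phase : ℕ → Maybe (Fin r)
    phase j with r₀ ≤? j | j <? M
    ... | yes _ | yes _ = just (j mod r)
    ... | yes _ | no _  = nothing
    ... | no _  | _     = nothing

    phase-just : ∀ j → r₀ ≤ j → j < M → phase j ≡ just (j mod r)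
    phase-just j r₀≤j j<M with r₀ ≤? j | j <? M
    ... | yes _ | yes _  = refl
    ... | yes _ | no ¬p  = ⊥-elim (¬p j<M)
    ... | no ¬p | _      = ⊥-elim (¬p r₀≤j)

    phase-early : ∀ j → j < r₀ → phase j ≡ nothing
    phase-early j j<r₀ with r₀ ≤? j
    ... | yes p = ⊥-elim (<-irrefl refl (<-≤-trans j<r₀ p))
    ... | no _  = refl

    phase-late : ∀ j → M ≤ j → phase j ≡ nothing
    phase-late j M≤j with r₀ ≤? j | j <? M
    ... | yes _ | yes p = ⊥-elim (<-irrefl refl (<-≤-trans p M≤j))
    ... | yes _ | no _  = refl
    ... | no _  | _     = refl

    phase-sound : ∀ j a → phase j ≡ just a → j % r ≡ toℕ a
    phase-sound j a eq with r₀ ≤? j | j <? M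
    phase-sound j a refl | yes _ | yes _ = sym (Fin.toℕ-fromℕ< (m%n<n j r))

    φ : ℕ → List (Fin r)
    φ j = maybe (replicate s) [] (phase j)

    phases : ℕ → ℕ → List (Fin r)
    phases j zero    = []
    phases j (suc n) = φ j ++ phases (suc j) n

    phases-++ : ∀ j m n → phases j (m + n) ≡ phases j m ++ phases (j + m) n
    phases-++ j zero    n rewrite +-identityʳ j = refl
    phases-++ j (suc m) n rewrite +-suc j m =
      trans (cong (φ j ++_) (phases-++ (suc j) m n)) (sym (++-assoc (φ j) _ _))

    -- Moving the window by one drops phase `j` and adds phase `j + M`. The first is too early and
    -- the second too late, so both contribute nothing.
    phases-shift : ∀ j m → suc m ≡ M → j < r₀ → phases j M ≡ phases (suc j) M
    phases-shift j m refl j<r₀ = begin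
      φ j ++ phases (suc j) m                ≡⟨ cong (λ p → maybe (replicate s) [] p ++ phases (suc j) m) (phase-early j j<r₀) ⟩
      phases (suc j) m                       ≡⟨ sym (++-identityʳ _) ⟩
      phases (suc j) m ++ []                 ≡⟨ cong (λ p → phases (suc j) m ++ maybe (replicate s) [] p ++ []) (sym (phase-late (suc j + m) (s≤s (m≤n+m m j)))) ⟩
      phases (suc j) m ++ phases (suc j + m) 1 ≡⟨ sym (phases-++ (suc j) m 1) ⟩
      phases (suc j) (m + 1)                 ≡⟨ cong (phases (suc j)) (+-comm m 1) ⟩
      phases (suc j) M                       ∎
      where open ≡-Reasoning

    phases-const : ∀ j → 1 ≤ M → j ≤ r₀ → phases j M ≡ phases 0 M
    phases-const zero    _           _    = refl
    phases-const (suc j) (s≤s {n = m} z≤n) j<r₀ =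
      trans (sym (phases-shift j m refl j<r₀)) (phases-const j (s≤s z≤n) (<⇒≤ j<r₀))

    length-phases : ∀ j n → r₀ ≤ j → j + n ≤ M → length (phases j n) ≡ n * s
    length-phases j zero    _    _  = refl
    length-phases j (suc n) r₀≤j le = trans (length-++ (φ j))
      (cong₂ _+_ (trans (cong (length ∘ maybe (replicate s) []) (phase-just j r₀≤j (≤-trans (s≤s (m≤m+n j n)) le′))) (length-replicate s))
                 (length-phases (suc j) n (m≤n⇒m≤1+n r₀≤j) le′))
      where
      le′ : suc (j + n) ≤ M
      le′ = subst (_≤ M) (+-suc j n) le

    rotate : ℕ → ℕ → List (Fin r) → Coloured r r
    rotate i zero    w = uncoloured r w
    rotate i (suc n) w = distribute (λ q → phase (i + toℕ q)) s (take ℓ w) ++ rotate (suc i) n (drop ℓ w)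

    word-rotate : ∀ i n w → map proj₁ (rotate i n w) ≡ w
    word-rotate i zero    w = word-uncoloured w
    word-rotate i (suc n) w = trans (map-++ proj₁ (distribute _ s (take ℓ w)) _)
      (trans (cong₂ _++_ (word-colourFirst _ _ (take ℓ w)) (word-rotate (suc i) n (drop ℓ w))) (take++drop≡id ℓ w))

    -- A number instead of a predicate: its block sum vanishes exactly when every segment has `s`
    -- copies of each letter, and its average obeys the union bound.
    deficient : List (Fin r) → ℕ
    deficient u = ∑ (allFin r) (λ a → ind (count a u <? s))

    not-deficient : ∀ u → deficient u ≡ 0 → ∀ a → s ≤ count a u
    not-deficient u d≡0 a with count a u <? s | ∈⇒≤∑ (allFin r) (λ a → ind (count a u <? s)) (∈-allFin a)
    ... | no ¬p | _ = ≮⇒≥ ¬p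
    ... | yes _ | p with subst (1 ≤_) d≡0 p
    ...   | ()

    read-rotate : ∀ i n w → blockSum ℓ deficient n w ≡ 0 → ∀ q → read q (rotate i n w) ≡ phases (i + toℕ q) n
    read-rotate i zero    w d≡0 q = read-uncoloured q w
    read-rotate i (suc n) w d≡0 q = trans (read-++ q (distribute _ s (take ℓ w)) _)
      (cong₂ _++_
        (read-distribute _ s (take ℓ w) distinct (not-deficient (take ℓ w) (m+n≡0⇒m≡0 _ d≡0)) q)
        (read-rotate (suc i) n (drop ℓ w) (m+n≡0⇒n≡0 (deficient (take ℓ w)) d≡0) q))
      where
      distinct : ∀ p q a → phase (i + toℕ p) ≡ just a → phase (i + toℕ q) ≡ just a → p ≡ q
      distinct p q a ep eq = mod-shift-injective r₀ i p q (trans (phase-sound _ a ep) (sym (phase-sound _ a eq)))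

    twins : ∀ J w → 1 ≤ M → J + r ≡ M → blockSum ℓ deficient M w ≡ 0 → HasTwins r w (J * s)
    twins J w 1≤M J+r≡M d≡0 = rotate 0 M w , word-rotate 0 M w , phases r₀ M , long ,
      λ q → trans (read-rotate 0 M w d≡0 q) (trans (phases-const (toℕ q) 1≤M (≤-pred (Fin.toℕ<n q))) (sym (phases-const r₀ 1≤M ≤-refl)))
      where
      open ≤-Reasoning
      long : J * s ≤ length (phases r₀ M)
      long = begin
        -- From `r₀` on there are `M - r₀` active phases; `J = M - r` of them are counted.
        J * s                                              ≡⟨ sym (length-phases r₀ J ≤-refl (subst (r₀ + J ≤_) J+r≡M (≤-trans (≤-reflexive (+-comm r₀ J)) (+-monoʳ-≤ J (n≤1+n r₀))))) ⟩
        length (phases r₀ J)                               ≤⟨ m≤m+n _ _ ⟩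
        length (phases r₀ J) + length (phases (r₀ + J) r)  ≡⟨ sym (length-++ (phases r₀ J)) ⟩
        length (phases r₀ J ++ phases (r₀ + J) r)          ≡⟨ cong length (sym (phases-++ r₀ J r)) ⟩
        length (phases r₀ (J + r))                         ≡⟨ cong (length ∘ phases r₀) J+r≡M ⟩
        length (phases r₀ M)                               ∎

  -- Presents letter counts as sums over blocks of length one, the form required by `weakLaw`.
  blockSum-count : ∀ {k} (a : Fin k) M w → length w ≡ M → blockSum 1 (count a) M w ≡ count a w
  blockSum-count a zero    []      refl = refl
  blockSum-count a (suc M) (x ∷ w) p =
    cong₂ _+_ (+-identityʳ _) (blockSum-count a M w (suc-injective p))

  ∑-ind-≟ : ∀ {k} (a : Fin k) → ∑ (allFin k) (λ x → ind (a Fin.≟ x)) ≡ 1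
  ∑-ind-≟ {suc k} zero    = trans (∑-allFin-suc k (λ x → ind (zero Fin.≟ x)))
    (cong suc (trans (∑-const 0 (allFin k)) (*-zeroʳ (length (allFin k)))))
  ∑-ind-≟ {suc k} (suc a) = trans (∑-allFin-suc k (λ x → ind (suc a Fin.≟ x)))
    (trans (∑-cong (allFin k) (λ {x} _ → same x)) (∑-ind-≟ a))
    where
    same : ∀ x → ind (suc a Fin.≟ suc x) ≡ ind (a Fin.≟ x)
    same x with a Fin.≟ x
    ... | yes _ = refl
    ... | no _  = refl

  ∑-count-letters : ∀ {k} (a : Fin k) → ∑ (words k 1) (count a) ≡ 1
  ∑-count-letters {k} a = trans (∑-words-suc 0 (count a))
    (trans (∑-cong (allFin k) (λ {x} _ → trans (+-identityʳ _) (+-identityʳ _))) (∑-ind-≟ a))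

  -- Three losses of a factor m / (m + 1) each: the quota `s` against the mean count `ℓ / r`, the
  -- `J` phases used out of `M`, and the words that have a deficient segment.
  module Base (r₀ m : ℕ) where
    r e : ℕ
    r = suc r₀
    -- This is `suc m * (M * r)`: a union bound over `M` segments and `r` letters then leaves
    -- probability at most 1 / (m + 1).
    e = suc m * (suc m * r * r)

    threshold : (a : Fin r) → ∃ λ M₀ → ∀ M → M₀ ≤ M →
      e * ∑ (words r (M * 1 + 0)) (λ w → ind (suc m * (r ^ 1 * blockSum 1 (count a) M w) <? m * (M * ∑ (words r 1) (count a)))) ≤ r ^ (M * 1 + 0)
    threshold a = weakLaw r 1 0 (count a) m e (≤-reflexive (sym (∑-count-letters a)))

    y ℓ s J M L : ℕ
    -- The sum dominates the threshold of every letter. With `ℓ = suc m * r * y` the mean count of a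
    -- letter is `suc m * y`, of which `s = m * y` is the share m / (m + 1).
    y = suc (∑ (allFin r) (proj₁ ∘ threshold))
    ℓ = suc m * r * y
    s = m * y
    J = m * r
    M = suc m * r
    L = M * ℓ + 0

    open Rotation r₀ s ℓ M using (deficient; twins)
    open Moments r ℓ 0 deficient

    letter-deficient : (a : Fin r) → e * ∑ (words r ℓ) (λ w → ind (count a w <? s)) ≤ r ^ ℓ
    letter-deficient a = begin
      e * ∑ (words r ℓ) (λ w → ind (count a w <? s))
        ≤⟨ *-monoʳ-≤ e (∑-mono (words r ℓ) (λ {w} w∈ → ind-mono (rescale w (words-length r ℓ w∈)) (count a w <? s) _)) ⟩
      e * ∑ (words r ℓ) b
        ≡⟨ cong (λ n → e * ∑ (words r n) b) (sym ℓ≡) ⟩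
      e * ∑ (words r (ℓ * 1 + 0)) b
        ≤⟨ proj₂ (threshold a) ℓ M₀≤ℓ ⟩
      r ^ (ℓ * 1 + 0)
        ≡⟨ cong (r ^_) ℓ≡ ⟩
      r ^ ℓ ∎
      where
      open ≤-Reasoning
      b : List (Fin r) → ℕ
      b w = ind (suc m * (r ^ 1 * blockSum 1 (count a) ℓ w) <? m * (ℓ * ∑ (words r 1) (count a)))
      ℓ≡ : ℓ * 1 + 0 ≡ ℓ
      ℓ≡ = trans (+-identityʳ _) (*-identityʳ ℓ)
      M₀≤ℓ : proj₁ (threshold a) ≤ ℓ
      M₀≤ℓ = ≤-trans (∈⇒≤∑ (allFin r) (proj₁ ∘ threshold) (∈-allFin a)) (≤-trans (n≤1+n _) (m≤n*m y (suc m * r)))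
      rescale : ∀ w → length w ≡ ℓ → count a w < s →
        suc m * (r ^ 1 * blockSum 1 (count a) ℓ w) < m * (ℓ * ∑ (words r 1) (count a))
      rescale w lw cw<s = subst₂ _<_
        (trans (*-assoc (suc m) r (count a w)) (cong₂ (λ p c → suc m * (p * c)) (sym (*-identityʳ r)) (sym (blockSum-count a ℓ w lw))))
        (trans (alg m r y) (cong (λ t → m * (ℓ * t)) (sym (∑-count-letters a))))
        (*-monoʳ-< (suc m * r) cw<s)
        where
        alg : ∀ m r y → (1 + m) * r * (m * y) ≡ m * ((1 + m) * r * y * 1)
        alg = solve-∀

    block-deficient : e * T ≤ r * N
    block-deficient = begin
      e * T
        ≡⟨ cong (e *_) (∑-swap (words r ℓ) (allFin r) (λ u a → ind (count a u <? s))) ⟩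
      e * ∑ (allFin r) (λ a → ∑ (words r ℓ) (λ u → ind (count a u <? s)))
        ≡⟨ sym (∑-*ˡ e (allFin r) _) ⟩
      ∑ (allFin r) (λ a → e * ∑ (words r ℓ) (λ u → ind (count a u <? s)))
        ≤⟨ ∑-mono (allFin r) (λ {a} _ → letter-deficient a) ⟩
      ∑ (allFin r) (λ _ → N)
        ≡⟨ trans (∑-const N (allFin r)) (cong (_* N) (length-tabulate {n = r} (λ i → i))) ⟩
      r * N ∎
      where open ≤-Reasoning

    word-deficient : suc m * E₁ M ≤ r ^ L
    word-deficient = *-cancelˡ-≤ (N * (M * r)) ⦃ m*n≢0 N (M * r) ⦃ m^n≢0 r ℓ ⦄ ⦄ (begin
      N * (M * r) * (suc m * E₁ M)   ≡⟨ alg₁ N M r (suc m) (E₁ M) ⟩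
      e * (N * E₁ M)                 ≡⟨ cong (e *_) (E₁-closed M) ⟩
      e * (M * T * size M)           ≡⟨ alg₂ e M T (size M) ⟩
      M * size M * (e * T)           ≤⟨ *-monoʳ-≤ (M * size M) block-deficient ⟩
      M * size M * (r * N)           ≡⟨ alg₃ M (size M) r N ⟩
      N * (M * r) * size M           ∎)
      where
      open ≤-Reasoning
      alg₁ : ∀ N M r m E → N * (M * r) * (m * E) ≡ m * (M * r) * (N * E)
      alg₁ = solve-∀
      alg₂ : ∀ e M T K → e * (M * T * K) ≡ M * K * (e * T)
      alg₂ = solve-∀
      alg₃ : ∀ M K r N → M * K * (r * N) ≡ N * (M * r) * K
      alg₃ = solve-∀

    X : List (Fin r) → ℕ
    X w with Z M w
    ... | zero  = J * s
    ... | suc _ = 0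

    X-twins : ∀ w → HasTwins r w (X w)
    X-twins w with Z M w in eq
    ... | zero  = twins J w (s≤s z≤n) (+-comm J r) eq
    ... | suc _ = hasTwins-0 w

    -- Markov's inequality pointwise: a word that gets value 0 has `Z M w` at least 1.
    X-value : ∀ w → J * s ≤ X w + J * s * Z M w
    X-value w with Z M w
    ... | zero  = m≤m+n (J * s) _
    ... | suc z = m≤m*n (J * s) (suc z)

    X-total : m * (J * s) * r ^ L ≤ suc m * ∑ (words r L) X
    X-total = +-cancelʳ-≤ (J * s * K) _ _ (begin
      m * (J * s) * K + J * s * K                           ≡⟨ alg₁ m (J * s) K ⟩
      suc m * (K * (J * s))                                 ≡⟨ cong (suc m *_) (sym (∑-words-const r L (J * s))) ⟩
      suc m * ∑ (words r L) (λ _ → J * s)                   ≤⟨ *-monoʳ-≤ (suc m) (∑-mono (words r L) (λ {w} _ → X-value w)) ⟩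
      suc m * ∑ (words r L) (λ w → X w + J * s * Z M w)     ≡⟨ cong (suc m *_) (trans (∑-+ (words r L) X _) (cong (∑ (words r L) X +_) (∑-*ˡ (J * s) (words r L) (Z M)))) ⟩
      suc m * (∑ (words r L) X + J * s * E₁ M)              ≡⟨ alg₂ (suc m) (∑ (words r L) X) (J * s) (E₁ M) ⟩
      suc m * ∑ (words r L) X + J * s * (suc m * E₁ M)      ≤⟨ +-monoʳ-≤ (suc m * ∑ (words r L) X) (*-monoʳ-≤ (J * s) word-deficient) ⟩
      suc m * ∑ (words r L) X + J * s * K                   ∎)
      where
      open ≤-Reasoning
      K = r ^ L
      alg₁ : ∀ m j K → m * j * K + j * K ≡ (1 + m) * (K * j)
      alg₁ = solve-∀
      alg₂ : ∀ m x j E → m * (x + j * E) ≡ m * x + j * (m * E)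
      alg₂ = solve-∀

    density : Density r r (m * m * m) (suc m * suc m * suc m * r)
    density = density-from-block (m * m * m) (suc m * suc m * suc m * r) (pred L) X X-twins
      (subst (λ L → m * m * m * L * r ^ L ≤ suc m * suc m * suc m * r * ∑ (words r L) X) (sym (suc-pred L)) bound)
      where
      open ≤-Reasoning
      bound : m * m * m * L * r ^ L ≤ suc m * suc m * suc m * r * ∑ (words r L) X
      bound = begin
        m * m * m * L * r ^ L                               ≡⟨ alg₁ m r y (r ^ L) ⟩
        suc m * suc m * r * (m * (J * s) * r ^ L)           ≤⟨ *-monoʳ-≤ (suc m * suc m * r) X-total ⟩
        suc m * suc m * r * (suc m * ∑ (words r L) X)       ≡⟨ alg₂ (suc m) r (∑ (words r L) X) ⟩
        suc m * suc m * suc m * r * ∑ (words r L) X         ∎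
        where
        alg₁ : ∀ m r y K → m * m * m * ((1 + m) * r * ((1 + m) * r * y) + 0) * K ≡ (1 + m) * (1 + m) * r * (m * (m * r * (m * y)) * K)
        alg₁ = solve-∀
        alg₂ : ∀ m r x → m * m * r * (m * x) ≡ m * m * m * r * x
        alg₂ = solve-∀

  -- Erasing and inserting the new letter

  -- The letter zero is the new one; red erases it.
  red : ∀ {k} → List (Fin (suc k)) → List (Fin k)
  red []          = []
  red (zero ∷ w)  = red w
  red (suc a ∷ w) = a ∷ red w

  -- Linear lower bounds survive averaging over the binomially distributed length of red w.
  ∑-red : ∀ {k} Q (h : List (Fin k) → ℕ) P e D →
    (∀ j → k ^ j * (P * j + e) ≤ Q * ∑ (words k j) h + k ^ j * D) →
    ∀ n → suc k ^ n * (P * n * k + e * suc k) ≤ suc k * (Q * ∑ (words (suc k) n) (h ∘ red) + suc k ^ n * D)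
  ∑-red {k} Q h P e D H zero = begin
    1 * (P * 0 * k + e * suc k)             ≡⟨ alg₁ P k e (suc k) ⟩
    suc k * (1 * (P * 0 + e))               ≤⟨ *-monoʳ-≤ (suc k) (H 0) ⟩
    suc k * (Q * (h [] + 0) + 1 * D)        ∎
    where
    open ≤-Reasoning
    alg₁ : ∀ P k e K → 1 * (P * 0 * k + e * K) ≡ K * (1 * (P * 0 + e))
    alg₁ = solve-∀
  ∑-red {k} Q h P e D H (suc n) = begin
    K * K ^ n * (P * suc n * k + e * K)
      ≡⟨ alg₁ k (K ^ n) P n e ⟩
    K ^ n * (P * n * k + e * K) + K ^ n * (k * P * n * k + k * (P + e) * K)
      -- Either the first letter is erased, or it is kept and absorbed into `h′`, whose slope,
      -- offset and loss differ. This is why the induction quantifies over `h`, `P`, `e` and `D`.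
      ≤⟨ +-mono-≤ (∑-red Q h P e D H n) (∑-red Q h′ (k * P) (k * (P + e)) (k * D) H′ n) ⟩
    K * (Q * S₁ + K ^ n * D) + K * (Q * S₂ + K ^ n * (k * D))
      ≡⟨ alg₂ k Q S₁ S₂ (K ^ n) D ⟩
    K * (Q * (S₁ + S₂) + K * K ^ n * D)
      ≡⟨ cong (λ s → K * (Q * s + K * K ^ n * D)) (sym sum-suc) ⟩
    K * (Q * ∑ (words K (suc n)) (h ∘ red) + K * K ^ n * D) ∎
    where
    open ≤-Reasoning
    K = suc k
    h′ : List (Fin k) → ℕ
    h′ w = ∑ (allFin k) (λ a → h (a ∷ w))
    S₁ = ∑ (words K n) (h ∘ red)
    S₂ = ∑ (words K n) (h′ ∘ red)
    sum-h′ : ∀ j → ∑ (words k (suc j)) h ≡ ∑ (words k j) h′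
    sum-h′ j = trans (∑-words-suc j h) (∑-swap (allFin k) (words k j) (λ a w → h (a ∷ w)))
    sum-suc : ∑ (words K (suc n)) (h ∘ red) ≡ S₁ + S₂
    sum-suc = trans (∑-words-suc n (h ∘ red)) (trans (∑-allFin-suc k _)
      (cong (S₁ +_) (∑-swap (allFin k) (words K n) (λ a w → h (a ∷ red w)))))
    H′ : ∀ j → k ^ j * (k * P * j + k * (P + e)) ≤ Q * ∑ (words k j) h′ + k ^ j * (k * D)
    H′ j = subst₂ _≤_ (alg k (k ^ j) P j e) (cong₂ _+_ (cong (Q *_) (sum-h′ j)) (alg′ k (k ^ j) D)) (H (suc j))
      where
      alg : ∀ k κ P j e → k * κ * (P * (1 + j) + e) ≡ κ * (k * P * j + k * (P + e))
      alg = solve-∀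
      alg′ : ∀ k κ D → k * κ * D ≡ κ * (k * D)
      alg′ = solve-∀
    alg₁ : ∀ k κ P n e → (1 + k) * κ * (P * (1 + n) * k + e * (1 + k)) ≡
      κ * (P * n * k + e * (1 + k)) + κ * (k * P * n * k + k * (P + e) * (1 + k))
    alg₁ = solve-∀
    alg₂ : ∀ k Q s t κ D → (1 + k) * (Q * s + κ * D) + (1 + k) * (Q * t + κ * (k * D)) ≡
      (1 + k) * (Q * (s + t) + (1 + k) * κ * D)
    alg₂ = solve-∀

  -- The number of zeros in the run just before the p-th letter of red w.
  gapAt : ∀ {k} → ℕ → List (Fin (suc k)) → ℕ
  gapAt p       []          = 0
  gapAt zero    (zero ∷ w)  = suc (gapAt zero w)
  gapAt (suc p) (zero ∷ w)  = gapAt (suc p) w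
  gapAt zero    (suc a ∷ w) = 0
  gapAt (suc p) (suc a ∷ w) = gapAt p w

  -- Adds a zero to the run whose length is `gapAt p w`. When `red w` has no p-th letter the zero
  -- joins the final run, so that every word grows by one letter and injectivity holds without a
  -- condition on `p`.
  bump : ∀ {k} → ℕ → List (Fin (suc k)) → List (Fin (suc k))
  bump zero    w           = zero ∷ w
  bump (suc p) []          = zero ∷ []
  bump (suc p) (zero ∷ w)  = zero ∷ bump (suc p) w
  bump (suc p) (suc a ∷ w) = suc a ∷ bump p w

  red-bump : ∀ {k} p (w : List (Fin (suc k))) → red (bump p w) ≡ red w
  red-bump zero    w           = refl
  red-bump (suc p) []          = refl
  red-bump (suc p) (zero ∷ w)  = red-bump (suc p) w
  red-bump (suc p) (suc a ∷ w) = cong (a ∷_) (red-bump p w)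

  length-bump : ∀ {k} p (w : List (Fin (suc k))) → length (bump p w) ≡ suc (length w)
  length-bump zero    w           = refl
  length-bump (suc p) []          = refl
  length-bump (suc p) (zero ∷ w)  = cong suc (length-bump (suc p) w)
  length-bump (suc p) (suc a ∷ w) = cong suc (length-bump p w)

  bump≢[] : ∀ {k} p (w : List (Fin (suc k))) → bump p w ≢ []
  bump≢[] zero    w           ()
  bump≢[] (suc p) []          ()
  bump≢[] (suc p) (zero ∷ w)  ()
  bump≢[] (suc p) (suc a ∷ w) ()

  bump-injective : ∀ {k} p {v w : List (Fin (suc k))} → bump p v ≡ bump p w → v ≡ w
  bump-injective zero    eq = proj₂ (∷-injective eq)
  bump-injective (suc p) {[]}        {[]}        eq = refl
  bump-injective (suc p) {[]}        {zero ∷ w}  eq = ⊥-elim (bump≢[] (suc p) w (sym (proj₂ (∷-injective eq))))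
  bump-injective (suc p) {[]}        {suc b ∷ w} ()
  bump-injective (suc p) {zero ∷ v}  {[]}        eq = ⊥-elim (bump≢[] (suc p) v (proj₂ (∷-injective eq)))
  bump-injective (suc p) {zero ∷ v}  {zero ∷ w}  eq = cong (zero ∷_) (bump-injective (suc p) (proj₂ (∷-injective eq)))
  bump-injective (suc p) {zero ∷ v}  {suc b ∷ w} ()
  bump-injective (suc p) {suc a ∷ v} {[]}        ()
  bump-injective (suc p) {suc a ∷ v} {zero ∷ w}  ()
  bump-injective (suc p) {suc a ∷ v} {suc b ∷ w} eq =
    cong₂ _∷_ (proj₁ (∷-injective eq)) (bump-injective p (proj₂ (∷-injective eq)))

  gapAt-bump : ∀ {k} p (w : List (Fin (suc k))) → p < length (red w) → gapAt p (bump p w) ≡ suc (gapAt p w)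
  gapAt-bump zero    w           p<  = refl
  gapAt-bump (suc p) (zero ∷ w)  p<  = gapAt-bump (suc p) w p<
  gapAt-bump (suc p) (suc a ∷ w) p<  = gapAt-bump p w (≤-pred p<)

  gapAt-bump-≤ : ∀ {k} i p (w : List (Fin (suc k))) → gapAt i w ≤ gapAt i (bump p w)
  gapAt-bump-≤ zero    zero    w           = n≤1+n _
  gapAt-bump-≤ (suc i) zero    w           = ≤-refl
  gapAt-bump-≤ i       (suc p) []          = z≤n
  gapAt-bump-≤ zero    (suc p) (zero ∷ w)  = s≤s (gapAt-bump-≤ zero (suc p) w)
  gapAt-bump-≤ (suc i) (suc p) (zero ∷ w)  = gapAt-bump-≤ (suc i) (suc p) w
  gapAt-bump-≤ zero    (suc p) (suc a ∷ w) = z≤n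
  gapAt-bump-≤ (suc i) (suc p) (suc a ∷ w) = gapAt-bump-≤ i p w

  module _ {k : ℕ} {A : Set} (p : A → ℕ) where

    bumpAll : List A → List (Fin (suc k)) → List (Fin (suc k))
    bumpAll qs w = foldr (λ q → bump (p q)) w qs

    red-bumpAll : ∀ qs w → red (bumpAll qs w) ≡ red w
    red-bumpAll []       w = refl
    red-bumpAll (q ∷ qs) w = trans (red-bump (p q) (bumpAll qs w)) (red-bumpAll qs w)

    length-bumpAll : ∀ qs w → length (bumpAll qs w) ≡ length qs + length w
    length-bumpAll []       w = refl
    length-bumpAll (q ∷ qs) w = trans (length-bump (p q) (bumpAll qs w)) (cong suc (length-bumpAll qs w))

    bumpAll-injective : ∀ qs {v w} → bumpAll qs v ≡ bumpAll qs w → v ≡ w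
    bumpAll-injective []       eq = eq
    bumpAll-injective (q ∷ qs) eq = bumpAll-injective qs (bump-injective (p q) eq)

    gapAt-bumpAll-≤ : ∀ i qs w → gapAt i w ≤ gapAt i (bumpAll qs w)
    gapAt-bumpAll-≤ i []       w = ≤-refl
    gapAt-bumpAll-≤ i (q ∷ qs) w = ≤-trans (gapAt-bumpAll-≤ i qs w) (gapAt-bump-≤ i (p q) (bumpAll qs w))

    -- The bump for `q` raises this gap by one, and no other bump lowers it.
    gapAt-bumpAll : ∀ {q} qs w → q ∈ qs → p q < length (red w) → gapAt (p q) w < gapAt (p q) (bumpAll qs w)
    gapAt-bumpAll (q ∷ qs) w (here refl) p< = ≤-trans (s≤s (gapAt-bumpAll-≤ (p q) qs w))
      (≤-reflexive (sym (gapAt-bump (p q) (bumpAll qs w) (subst (λ v → p q < length v) (sym (red-bumpAll qs w)) p<))))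
    gapAt-bumpAll (q ∷ qs) w (there q∈)  p< =
      ≤-trans (gapAt-bumpAll qs w q∈ p<) (gapAt-bump-≤ _ (p q) (bumpAll qs w))

  -- Extending twins by runs of the new letter

  choose : {P A : Set} → Dec P → A → A → A
  choose (yes _) x y = x
  choose (no _)  x y = y

  delay : (ℕ → ℕ) → ℕ → ℕ
  delay f zero    = 0
  delay f (suc i) = suc (f i)

  -- The index in c of the i-th letter of colour q.
  pos : ∀ {r k} → Fin r → Coloured r k → ℕ → ℕ
  pos q []                  i = 0
  pos q ((a , nothing) ∷ c) i = suc (pos q c i)
  pos q ((a , just p) ∷ c)  i = choose (p Fin.≟ q) (delay (pos q c) i) (suc (pos q c i))

  pos-< : ∀ {r k} (q : Fin r) (c : Coloured r k) i → i < length (read q c) → pos q c i < length c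
  pos-< q ((a , nothing) ∷ c) i i< = s≤s (pos-< q c i i<)
  pos-< q ((a , just p) ∷ c)  i i< with p Fin.≟ q
  pos-< q ((a , just p) ∷ c) zero    i< | yes _ = s≤s z≤n
  pos-< q ((a , just p) ∷ c) (suc i) i< | yes _ = s≤s (pos-< q c i (≤-pred i<))
  pos-< q ((a , just p) ∷ c) i       i< | no _  = s≤s (pos-< q c i i<)

  weave : ∀ {k} → (ℕ → ℕ) → List (Fin k) → List (Fin (suc k))
  weave m []      = []
  weave m (a ∷ u) = replicate (m 0) zero ++ suc a ∷ weave (m ∘ suc) u

  ∑-upTo-suc : ∀ n (f : ℕ → ℕ) → ∑ (upTo (suc n)) f ≡ f 0 + ∑ (upTo n) (f ∘ suc)
  ∑-upTo-suc n f = cong (f 0 +_) (trans (cong (λ xs → ∑ xs f) (sym (map-applyUpTo (λ i → i) suc n))) (∑-map suc (upTo n) f))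

  length-weave : ∀ {k} m (u : List (Fin k)) → length (weave m u) ≡ length u + ∑ (upTo (length u)) m
  length-weave m []      = refl
  length-weave m (a ∷ u) = begin
    length (replicate (m 0) zero ++ suc a ∷ weave (m ∘ suc) u)
      ≡⟨ length-++ (replicate (m 0) zero) ⟩
    length (replicate (m 0) (zero {_})) + suc (length (weave (m ∘ suc) u))
      ≡⟨ cong₂ (λ x y → x + suc y) (length-replicate (m 0)) (length-weave (m ∘ suc) u) ⟩
    m 0 + suc (length u + ∑ (upTo (length u)) (m ∘ suc))
      ≡⟨ alg (m 0) (length u) (∑ (upTo (length u)) (m ∘ suc)) ⟩
    suc (length u) + (m 0 + ∑ (upTo (length u)) (m ∘ suc))
      ≡⟨ cong (suc (length u) +_) (sym (∑-upTo-suc (length u) m)) ⟩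
    suc (length u) + ∑ (upTo (suc (length u))) m ∎
    where
    open ≡-Reasoning
    alg : ∀ a b c → a + suc (b + c) ≡ suc b + (a + c)
    alg = solve-∀

  predHead : (ℕ → ℕ) → ℕ → ℕ
  predHead f zero    = pred (f zero)
  predHead f (suc i) = f (suc i)

  -- Colours m q i zeros of the run before the i-th letter of colour q with colour q.
  expand : ∀ {r k} → (Fin r → ℕ → ℕ) → Coloured r k → List (Fin (suc k)) → Coloured r (suc k)
  expand m c                   []          = []
  expand m []                  (x ∷ w)     = uncoloured _ (x ∷ w)
  expand m ((a , nothing) ∷ c) (zero ∷ w)  = (zero , nothing) ∷ expand m ((a , nothing) ∷ c) w
  expand m ((a , just p) ∷ c)  (zero ∷ w)  = (zero , activeColour (m p 0) (just p)) ∷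
    expand (λ q → choose (p Fin.≟ q) (predHead (m q)) (m q)) ((a , just p) ∷ c) w
  expand m ((a , nothing) ∷ c) (suc b ∷ w) = (suc b , nothing) ∷ expand m c w
  expand m ((a , just p) ∷ c)  (suc b ∷ w) = (suc b , just p) ∷ expand (λ q → choose (p Fin.≟ q) (m q ∘ suc) (m q)) c w

  word-expand : ∀ {r k} m (c : Coloured r k) w → map proj₁ (expand m c w) ≡ w
  word-expand m c                   []          = refl
  word-expand m []                  (x ∷ w)     = word-uncoloured (x ∷ w)
  word-expand m ((a , nothing) ∷ c) (zero ∷ w)  = cong (zero ∷_) (word-expand m _ w)
  word-expand m ((a , just p) ∷ c)  (zero ∷ w)  = cong (zero ∷_) (word-expand _ _ w)
  word-expand m ((a , nothing) ∷ c) (suc b ∷ w) = cong (suc b ∷_) (word-expand m c w)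
  word-expand m ((a , just p) ∷ c)  (suc b ∷ w) = cong (suc b ∷_) (word-expand _ c w)

  -- A run of zeros is offered only to the twin that owns the next letter, so the readings develop
  -- independently of each other; `fits` says that no run ends before its quota is met.
  read-expand : ∀ {r k} (q : Fin r) m (c : Coloured r k) w → red w ≡ map proj₁ c →
    (∀ i → i < length (read q c) → m q i ≤ gapAt (pos q c i) w) →
    read q (expand m c w) ≡ weave (m q) (read q c)
  read-expand q m []      []      rw fits = refl
  read-expand q m []      (x ∷ w) rw fits = read-uncoloured q (x ∷ w)
  read-expand q m (_ ∷ _) []      () fits
  read-expand q m ((a , nothing) ∷ c) (zero ∷ w) rw fits = read-expand q m ((a , nothing) ∷ c) w rw fits
  read-expand q m ((a , just p) ∷ c)  (zero ∷ w) rw fits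
    with m p 0 in mp | read-expand q (λ q → choose (p Fin.≟ q) (predHead (m q)) (m q)) ((a , just p) ∷ c) w rw
  ... | zero  | ih with p Fin.≟ q
  ...   | yes refl = trans (ih λ { zero i< → pred-mono-≤ (fits 0 i<) ; (suc i) i< → fits (suc i) i< })
    (cong (λ n → replicate n zero ++ suc a ∷ weave (m p ∘ suc) (read p c)) (trans (cong pred mp) (sym mp)))
  ...   | no _     = ih fits
  read-expand q m ((a , just p) ∷ c)  (zero ∷ w) rw fits
      | suc n | ih with p Fin.≟ q
  ...   | yes refl = trans (cong (zero ∷_) (ih λ { zero i< → pred-mono-≤ (fits 0 i<) ; (suc i) i< → fits (suc i) i< }))
    (trans (cong (λ n → zero ∷ replicate (pred n) zero ++ suc a ∷ weave (m p ∘ suc) (read p c)) mp)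
      (cong (λ n → replicate n zero ++ suc a ∷ weave (m p ∘ suc) (read p c)) (sym mp)))
  ...   | no _     = ih fits
  read-expand q m ((a , nothing) ∷ c) (suc b ∷ w) rw fits = read-expand q m c w (proj₂ (∷-injective rw)) fits
  read-expand q m ((a , just p) ∷ c)  (suc b ∷ w) rw fits
    with read-expand q (λ q → choose (p Fin.≟ q) (m q ∘ suc) (m q)) c w (proj₂ (∷-injective rw))
  ... | ih with p Fin.≟ q
  -- The next letter has arrived, so the gap before it is 0 and `fits` forces the remaining quota to
  -- be 0.
  ...   | yes refl = trans (cong (suc b ∷_) (ih λ i i< → fits (suc i) (s≤s i<)))
    (cong₂ (λ n b → replicate n zero ++ suc b ∷ weave (m p ∘ suc) (read p c)) (sym (n≤0⇒n≡0 (fits 0 (s≤s z≤n)))) (proj₁ (∷-injective rw)))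
  ...   | no _     = ih fits

  -- The step from k to k + 1 letters

  minimum : ∀ {r} → (Fin (suc r) → ℕ) → ℕ
  minimum {zero}  f = f zero
  minimum {suc r} f = f zero ⊓ minimum (f ∘ suc)

  minimum-≤ : ∀ {r} (f : Fin (suc r) → ℕ) q → minimum f ≤ f q
  minimum-≤ {zero}  f zero    = ≤-refl
  minimum-≤ {suc r} f zero    = m⊓n≤m (f zero) _
  minimum-≤ {suc r} f (suc q) = ≤-trans (m⊓n≤n (f zero) _) (minimum-≤ (f ∘ suc) q)

  ≤-minimum : ∀ {r} (f : Fin (suc r) → ℕ) c → (∀ q → c ≤ f q) → c ≤ minimum f
  ≤-minimum {zero}  f c h = h zero
  ≤-minimum {suc r} f c h = ⊓-glb (h zero) (≤-minimum (f ∘ suc) c (h ∘ suc))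

  -- Pads a sum whose range depends on the word to a range common to all words, so that the order of
  -- summation can be exchanged.
  truncate : ℕ → (ℕ → ℕ) → ℕ → ℕ
  truncate n f i = ind (i <? n) * f i

  ∑-truncate-suc : ∀ N n f → ∑ (upTo (suc N)) (truncate (suc n) f) ≡ f 0 + ∑ (upTo N) (truncate n (f ∘ suc))
  ∑-truncate-suc N n f = trans (∑-upTo-suc N (truncate (suc n) f)) (cong₂ _+_ (+-identityʳ (f 0))
    (∑-cong (upTo N) (λ {i} _ → cong (_* f (suc i)) (≤-antisym
      (ind-mono ≤-pred (suc i <? suc n) (i <? n)) (ind-mono s≤s (i <? n) (suc i <? suc n))))))

  ∑-truncate-≤ : ∀ N n f → ∑ (upTo N) (truncate n f) ≤ ∑ (upTo n) f
  ∑-truncate-≤ zero    n       f = z≤n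
  ∑-truncate-≤ (suc N) zero    f = ≤-reflexive (trans (∑-cong (upTo (suc N)) {g = λ _ → 0} (λ {i} _ → none i))
    (trans (∑-const 0 (upTo (suc N))) (*-zeroʳ (length (upTo (suc N))))))
    where
    none : ∀ i → truncate 0 f i ≡ 0
    none i with i <? 0
    ... | no _ = refl
  ∑-truncate-≤ (suc N) (suc n) f = begin
    ∑ (upTo (suc N)) (truncate (suc n) f)       ≡⟨ ∑-truncate-suc N n f ⟩
    f 0 + ∑ (upTo N) (truncate n (f ∘ suc))     ≤⟨ +-monoʳ-≤ (f 0) (∑-truncate-≤ N n (f ∘ suc)) ⟩
    f 0 + ∑ (upTo n) (f ∘ suc)                  ≡⟨ sym (∑-upTo-suc n f) ⟩
    ∑ (upTo (suc n)) f                          ∎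
    where open ≤-Reasoning

  ∑-≤-truncate : ∀ N n f → n ≤ N → ∑ (upTo n) f ≤ ∑ (upTo N) (truncate n f)
  ∑-≤-truncate N       zero    f n≤N = z≤n
  ∑-≤-truncate (suc N) (suc n) f n≤N = begin
    ∑ (upTo (suc n)) f                          ≡⟨ ∑-upTo-suc n f ⟩
    f 0 + ∑ (upTo n) (f ∘ suc)                  ≤⟨ +-monoʳ-≤ (f 0) (∑-≤-truncate N n (f ∘ suc) (≤-pred n≤N)) ⟩
    f 0 + ∑ (upTo N) (truncate n (f ∘ suc))     ≡⟨ sym (∑-truncate-suc N n f) ⟩
    ∑ (upTo (suc N)) (truncate (suc n) f)       ∎
    where open ≤-Reasoning

  -- Twins of red w, each letter preceded by as many zeros as all r twins can afford there.
  module NewLetter (r₀ k : ℕ) (X : List (Fin k) → ℕ) (X-twins : ∀ w → HasTwins (suc r₀) w (X w)) where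
    r K : ℕ
    r = suc r₀
    K = suc k

    c : List (Fin k) → Coloured r k
    c w = proj₁ (X-twins w)

    common : List (Fin k) → List (Fin k)
    common w = proj₁ (proj₂ (proj₂ (X-twins w)))

    s : List (Fin k) → ℕ
    s w = length (common w)

    X≤s : ∀ w → X w ≤ s w
    X≤s w = proj₁ (proj₂ (proj₂ (proj₂ (X-twins w))))

    read-c : ∀ w q → read q (c w) ≡ common w
    read-c w = proj₂ (proj₂ (proj₂ (proj₂ (X-twins w))))

    word-c : ∀ w → map proj₁ (c w) ≡ w
    word-c w = proj₁ (proj₂ (X-twins w))

    position : List (Fin k) → ℕ → Fin r → ℕ
    position v i q = pos q (c v) i

    position-< : ∀ v i q → i < s v → position v i q < length v
    position-< v i q i< = subst (λ u → position v i q < length u) (word-c v)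
      (≤-trans (pos-< q (c v) i (subst (λ u → i < length u) (sym (read-c v q)) i<))
               (≤-reflexive (sym (length-map proj₁ (c v)))))

    gain : List (Fin K) → ℕ → ℕ
    gain w i = minimum (λ q → gapAt (position (red w) i q) w)

    Y : List (Fin K) → ℕ
    Y w = s (red w) + ∑ (upTo (s (red w))) (gain w)

    Y-twins : ∀ w → HasTwins r w (Y w)
    Y-twins w = expand (λ _ → gain w) (c (red w)) w , word-expand _ (c (red w)) w ,
      weave (gain w) (common (red w)) , ≤-reflexive (sym (length-weave (gain w) (common (red w)))) ,
      λ q → trans (read-expand q (λ _ → gain w) (c (red w)) w (sym (word-c (red w)))
                     (λ i _ → minimum-≤ (λ q → gapAt (position (red w) i q) w) q))
                  (cong (weave (gain w)) (read-c (red w) q))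

    insert : ℕ → List (Fin K) → List (Fin K)
    insert i v = bumpAll (position (red v) i) (allFin r) v

    red-insert : ∀ i v → red (insert i v) ≡ red v
    red-insert i v = red-bumpAll (position (red v) i) (allFin r) v

    -- Insertion preserves `red`, so words with equal images have the same positions, and bumping at
    -- fixed positions is injective.
    insert-injective : ∀ i {v w} → insert i v ≡ insert i w → v ≡ w
    insert-injective i {v} {w} eq = bumpAll-injective (position (red v) i) (allFin r)
      (trans eq (cong (λ u → bumpAll (position u i) (allFin r) w)
        (trans (sym (red-insert i w)) (trans (cong red (sym eq)) (red-insert i v)))))

    length-insert : ∀ i v → length (insert i v) ≡ r + length v
    length-insert i v = trans (length-bumpAll (position (red v) i) (allFin r) v)
      (cong (_+ length v) (length-tabulate {n = r} (λ q → q)))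

    gain-insert : ∀ i v → i < s (red v) → gain v i < gain (insert i v) i
    gain-insert i v i< rewrite red-insert i v =
      ≤-minimum _ _ λ q → ≤-trans (s≤s (minimum-≤ (λ q → gapAt (position (red v) i q) v) q))
        (gapAt-bumpAll (position (red v) i) (allFin r) v (∈-allFin q) (position-< (red v) i q i<))

    A B : ℕ → ℕ
    A n = ∑ (words K n) Y
    B n = ∑ (words K n) (s ∘ red)

    -- insert i is injective, keeps red, and raises the i-th gain by at least one.
    total-gain : ∀ n → A n ≤ ∑ (words K (r + n)) (λ w → ∑ (upTo (s (red w))) (gain w))
    total-gain n = begin
      A n
        ≤⟨ ∑-mono (words K n) (λ {v} v∈ → ≤-trans (≤-reflexive (Y-∑ v)) (∑-≤-truncate N (s (red v)) (suc ∘ gain v) (∈⇒≤∑ (words K n) (s ∘ red) v∈))) ⟩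
      ∑ (words K n) (λ v → ∑ (upTo N) (truncate (s (red v)) (suc ∘ gain v)))
        ≡⟨ ∑-swap (words K n) (upTo N) _ ⟩
      ∑ (upTo N) (λ i → ∑ (words K n) (λ v → truncate (s (red v)) (suc ∘ gain v) i))
        ≤⟨ ∑-mono (upTo N) (λ {i} _ → at i) ⟩
      ∑ (upTo N) (λ i → ∑ (words K (r + n)) (λ w → truncate (s (red w)) (gain w) i))
        ≡⟨ sym (∑-swap (words K (r + n)) (upTo N) _) ⟩
      ∑ (words K (r + n)) (λ w → ∑ (upTo N) (truncate (s (red w)) (gain w)))
        ≤⟨ ∑-mono (words K (r + n)) (λ {w} _ → ∑-truncate-≤ N (s (red w)) (gain w)) ⟩
      ∑ (words K (r + n)) (λ w → ∑ (upTo (s (red w))) (gain w)) ∎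
      where
      open ≤-Reasoning
      -- A common bound for all `s (red v)`: a single term is at most the sum.
      N = B n
      -- The letters counted by `s` supply exactly the one by which insertion raises each gain.
      Y-∑ : ∀ v → Y v ≡ ∑ (upTo (s (red v))) (suc ∘ gain v)
      Y-∑ v = sym (trans (∑-+ (upTo (s (red v))) (λ _ → 1) (gain v)) (cong (_+ ∑ (upTo (s (red v))) (gain v))
        (trans (∑-const 1 (upTo (s (red v)))) (trans (*-identityʳ _) (length-upTo (s (red v)))))))
      grow : ∀ i v → truncate (s (red v)) (suc ∘ gain v) i ≤ truncate (s (red (insert i v))) (gain (insert i v)) i
      grow i v = subst (λ u → truncate (s (red v)) (suc ∘ gain v) i ≤ truncate (s u) (gain (insert i v)) i) (sym (red-insert i v)) below
        where
        below : truncate (s (red v)) (suc ∘ gain v) i ≤ truncate (s (red v)) (gain (insert i v)) i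
        below with i <? s (red v)
        ... | yes i< = +-monoˡ-≤ 0 (gain-insert i v i<)
        ... | no _   = z≤n
      at : ∀ i → ∑ (words K n) (λ v → truncate (s (red v)) (suc ∘ gain v) i) ≤
                 ∑ (words K (r + n)) (λ w → truncate (s (red w)) (gain w) i)
      at i = ≤-trans (∑-mono (words K n) (λ {v} _ → grow i v))
        (∑-injection (insert i) (words K n) (words K (r + n)) _ (insert-injective i) (words-unique K n)
          (λ {v} v∈ → words-complete K (r + n) _ (trans (length-insert i v) (cong (r +_) (words-length K n v∈)))))

    A-recurrence : ∀ n → B (r + n) + A n ≤ A (r + n)
    A-recurrence n = ≤-trans (+-monoʳ-≤ (B (r + n)) (total-gain n)) (≤-reflexive (sym (∑-+ (words K (r + n)) (s ∘ red) _)))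

    B-bound : ∀ P Q D → (∀ j → P * j * k ^ j ≤ Q * ∑ (words k j) X + D * k ^ j) →
      ∀ n → P * k * n * K ^ n ≤ Q * K * B n + K * D * K ^ n
    B-bound P Q D X-bound n = subst₂ _≤_ (alg₁ (K ^ n) P n k) (alg₂ K Q (B n) (K ^ n) D)
      (∑-red Q s P 0 D H n)
      where
      open ≤-Reasoning
      H : ∀ j → k ^ j * (P * j + 0) ≤ Q * ∑ (words k j) s + k ^ j * D
      H j = begin
        k ^ j * (P * j + 0)                     ≡⟨ trans (cong (k ^ j *_) (+-identityʳ _)) (*-comm (k ^ j) (P * j)) ⟩
        P * j * k ^ j                           ≤⟨ X-bound j ⟩
        Q * ∑ (words k j) X + D * k ^ j         ≤⟨ +-mono-≤ (*-monoʳ-≤ Q (∑-mono (words k j) (λ {w} _ → X≤s w))) (≤-reflexive (*-comm D (k ^ j))) ⟩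
        Q * ∑ (words k j) s + k ^ j * D         ∎
      alg₁ : ∀ κ P n k → κ * (P * n * k + 0) ≡ P * k * n * κ
      alg₁ = solve-∀
      alg₂ : ∀ K Q b κ D → K * (Q * b + κ * D) ≡ Q * K * b + K * D * κ
      alg₂ = solve-∀

    -- After division by `K ^ n` the recurrence reads a(n + r) ≥ b(n + r) + a(n) / K^r, so a linear
    -- bound on b passes to a with its slope divided by 1 - K^(-r).
    A-bound : ∀ g P Q D → K ^ r ≡ suc g → 1 ≤ g → (∀ n → P * n * K ^ n ≤ Q * B n + D * K ^ n) →
      ∀ n → P * K ^ r * n * K ^ n ≤ Q * g * A n + suc g * (P * r + D) * K ^ n
    A-bound g P Q D Kʳ 1≤g B-bound rewrite Kʳ = <-rec _ step
      where
      open ≤-Reasoning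
      -- The fixed point of the error recursion: `g * suc g * (P * r + D) + E` equals `suc g * E`.
      E = suc g * (P * r + D)
      Goal : ℕ → Set
      Goal n = P * suc g * n * K ^ n ≤ Q * g * A n + E * K ^ n
      long : ∀ n → Goal n → Goal (r + n)
      long n ih = begin
        P * suc g * (r + n) * K ^ (r + n)
          ≡⟨ cong (P * suc g * (r + n) *_) κ≡ ⟩
        P * suc g * (r + n) * (suc g * κ)
          ≡⟨ alg₁ P g r n κ ⟩
        g * (P * (r + n) * (suc g * κ)) + P * suc g * n * κ + 1 * (P * r * suc g * κ)
          -- The error `P * r` is enlarged by the factor `g`, so that it scales like `D`.
          ≤⟨ +-mono-≤ (+-mono-≤ (*-monoʳ-≤ g B′) ih) (*-monoˡ-≤ (P * r * suc g * κ) 1≤g) ⟩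
        g * (Q * B (r + n) + D * (suc g * κ)) + (Q * g * A n + E * κ) + g * (P * r * suc g * κ)
          ≡⟨ alg₂ P g r κ Q D (B (r + n)) (A n) ⟩
        Q * g * (B (r + n) + A n) + E * (suc g * κ)
          ≤⟨ +-monoˡ-≤ _ (*-monoʳ-≤ (Q * g) (A-recurrence n)) ⟩
        Q * g * A (r + n) + E * (suc g * κ)
          ≡⟨ cong (λ x → Q * g * A (r + n) + E * x) (sym κ≡) ⟩
        Q * g * A (r + n) + E * K ^ (r + n) ∎
        where
        κ = K ^ n
        κ≡ : K ^ (r + n) ≡ suc g * κ
        κ≡ = trans (^-distribˡ-+-* K r n) (cong (_* κ) Kʳ)
        B′ : P * (r + n) * (suc g * κ) ≤ Q * B (r + n) + D * (suc g * κ)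
        B′ = subst (λ x → P * (r + n) * x ≤ Q * B (r + n) + D * x) κ≡ (B-bound (r + n))
        alg₁ : ∀ P g r n κ → P * (1 + g) * (r + n) * ((1 + g) * κ) ≡ g * (P * (r + n) * ((1 + g) * κ)) + P * (1 + g) * n * κ + 1 * (P * r * (1 + g) * κ)
        alg₁ = solve-∀
        alg₂ : ∀ P g r κ Q D b a → g * (Q * b + D * ((1 + g) * κ)) + (Q * g * a + (1 + g) * (P * r + D) * κ) + g * (P * r * (1 + g) * κ) ≡
          Q * g * (b + a) + (1 + g) * (P * r + D) * ((1 + g) * κ)
        alg₂ = solve-∀
      step : ∀ n → (∀ {m} → m < n → Goal m) → Goal n
      step n ih with r ≤? n
      ... | yes r≤n = subst Goal (m+[n∸m]≡n r≤n) (long (n ∸ r) (ih (∸-monoʳ-< (s≤s z≤n) r≤n)))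
      -- For `n < r` the part `P * r` of `E` already covers the left side.
      ... | no r≰n  = begin
        P * suc g * n * K ^ n                 ≤⟨ *-monoˡ-≤ (K ^ n) (*-monoʳ-≤ (P * suc g) (<⇒≤ (≰⇒> r≰n))) ⟩
        P * suc g * r * K ^ n                 ≤⟨ *-monoˡ-≤ (K ^ n) (≤-trans (≤-reflexive (alg P g r)) (*-monoʳ-≤ (suc g) (m≤m+n (P * r) D))) ⟩
        E * K ^ n                             ≤⟨ m≤n+m _ _ ⟩
        Q * g * A n + E * K ^ n               ∎
        where
        alg : ∀ P g r → P * (1 + g) * r ≡ (1 + g) * (P * r)
        alg = solve-∀

  density-new-letter : ∀ {r₀ k P Q} → Density (suc r₀) (suc k) P Q →
    Density (suc r₀) (suc (suc k)) (P * suc k * suc (suc k) ^ suc r₀) (Q * suc (suc k) * (suc (suc k) ^ suc r₀ ∸ 1))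
  density-new-letter {r₀} {k} {P} {Q} (X , X-twins , D , X-bound) =
    Y , Y-twins , suc g * (P * suc k * r + K * D) ,
    A-bound g (P * suc k) (Q * K) (K * D) Kʳ (≤-pred (≤-trans (s≤s (s≤s z≤n)) (≤-trans (m≤m*n K (K ^ r₀) ⦃ m^n≢0 K r₀ ⦄) (≤-reflexive Kʳ))))
      (B-bound P Q D X-bound)
    where
    open NewLetter r₀ (suc k) X X-twins
    g = K ^ r ∸ 1
    Kʳ : K ^ r ≡ suc g
    Kʳ = sym (m+[n∸m]≡n (m^n>0 K r))

  -- From colourings to index sets

  nth : {A : Set} → List A → ℕ → Maybe A
  nth []       i       = nothing
  nth (x ∷ xs) zero    = just x
  nth (x ∷ xs) (suc i) = nth xs i

  nth-map : {A B : Set} (f : A → B) (xs : List A) (i : ℕ) → nth (map f xs) i ≡ Maybe.map f (nth xs i)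
  nth-map f []       i       = refl
  nth-map f (x ∷ xs) zero    = refl
  nth-map f (x ∷ xs) (suc i) = nth-map f xs i

  nth-toList : {A : Set} {n : ℕ} (xs : Vec A n) (i : Fin n) → nth (toList xs) (toℕ i) ≡ just (lookup xs i)
  nth-toList (x ∷ xs) zero    = refl
  nth-toList (x ∷ xs) (suc i) = nth-toList xs i

  pos-nth : ∀ {r k} (q : Fin r) (c : Coloured r k) i → i < length (read q c) →
    ∃ λ a → nth c (pos q c i) ≡ just (a , just q) × nth (read q c) i ≡ just a
  pos-nth q ((a , nothing) ∷ c) i i< = pos-nth q c i i<
  pos-nth q ((a , just p) ∷ c)  i i< with p Fin.≟ q
  pos-nth q ((a , just p) ∷ c)  zero    i< | yes refl = a , refl , refl
  pos-nth q ((a , just p) ∷ c)  (suc i) i< | yes refl = pos-nth q c i (≤-pred i<)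
  pos-nth q ((a , just p) ∷ c)  i       i< | no _     = pos-nth q c i i<

  pos-mono : ∀ {r k} (q : Fin r) (c : Coloured r k) i j → i < j → j < length (read q c) → pos q c i < pos q c j
  pos-mono q ((a , nothing) ∷ c) i j i<j j< = s≤s (pos-mono q c i j i<j j<)
  pos-mono q ((a , just p) ∷ c)  i j i<j j< with p Fin.≟ q
  pos-mono q ((a , just p) ∷ c)  zero    (suc j) i<j j< | yes _ = s≤s z≤n
  pos-mono q ((a , just p) ∷ c)  (suc i) (suc j) i<j j< | yes _ = s≤s (pos-mono q c i j (≤-pred i<j) (≤-pred j<))
  pos-mono q ((a , just p) ∷ c)  i       j       i<j j< | no _  = s≤s (pos-mono q c i j i<j j<)

  -- The letter at a position bears at most one colour, so equal indices force equal twins.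
  twins⇒Twins : ∀ {r k n} (w : Word k n) (c : Coloured r k) u → map proj₁ c ≡ toList w → (∀ q → read q c ≡ u) →
    Twins r (length u) w
  twins⇒Twins {r} {k} {n} w c u word-c read-c = record
    { idx        = idx
    ; increasing = λ q a b a<b → subst₂ _<_ (sym (toℕ-idx q a)) (sym (toℕ-idx q b)) (pos-mono q c (toℕ a) (toℕ b) a<b (bound q b))
    ; disjoint   = λ q q′ q≢q′ a b eq → q≢q′ (sameColour q q′ a b (trans (sym (toℕ-idx q a)) (trans (cong toℕ eq) (toℕ-idx q′ b))))
    ; same       = λ q q′ a → just-injective (trans (letter q a) (sym (letter q′ a)))
    }
    where
    length-c : length c ≡ n
    length-c = trans (sym (length-map proj₁ c)) (trans (cong length word-c) (Vec.length-toList w))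
    bound : ∀ q (a : Fin (length u)) → toℕ a < length (read q c)
    bound q a = subst (λ v → toℕ a < length v) (sym (read-c q)) (Fin.toℕ<n a)
    below : ∀ q a → pos q c (toℕ a) < n
    below q a = subst (pos q c (toℕ a) <_) length-c (pos-< q c (toℕ a) (bound q a))
    idx : Fin r → Fin (length u) → Fin n
    idx q a = fromℕ< (below q a)
    toℕ-idx : ∀ q a → toℕ (idx q a) ≡ pos q c (toℕ a)
    toℕ-idx q a = Fin.toℕ-fromℕ< (below q a)
    sameColour : ∀ q q′ a b → pos q c (toℕ a) ≡ pos q′ c (toℕ b) → q ≡ q′
    sameColour q q′ a b eq with pos-nth q c (toℕ a) (bound q a) | pos-nth q′ c (toℕ b) (bound q′ b)
    ... | x , cx , _ | y , cy , _ = just-injective (cong proj₂ (just-injective (trans (sym cx) (trans (cong (nth c) eq) cy))))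
    letter : ∀ q a → just (lookup w (idx q a)) ≡ nth u (toℕ a)
    letter q a with pos-nth q c (toℕ a) (bound q a)
    ... | x , cx , rx = begin
      just (lookup w (idx q a))                      ≡⟨ sym (nth-toList w (idx q a)) ⟩
      nth (toList w) (toℕ (idx q a))                 ≡⟨ cong₂ nth (sym word-c) (toℕ-idx q a) ⟩
      nth (map proj₁ c) (pos q c (toℕ a))            ≡⟨ nth-map proj₁ c _ ⟩
      Maybe.map proj₁ (nth c (pos q c (toℕ a)))      ≡⟨ cong (Maybe.map proj₁) cx ⟩
      just x                                         ≡⟨ sym rx ⟩
      nth (read q c) (toℕ a)                         ≡⟨ cong (λ v → nth v (toℕ a)) (read-c q) ⟩
      nth u (toℕ a)                                  ∎
      where open ≡-Reasoning

  hasTwins-≤-max : ∀ {r k n s t} (w : Word k n) → HasTwins r (toList w) s → IsMaxTwinLength r w t → s ≤ t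
  hasTwins-≤-max w (c , word-c , u , s≤ , read-c) (_ , max) = ≤-trans s≤ (max (length u) (twins⇒Twins w c u word-c read-c))

  -- Counting words as vectors

  vecs : ∀ k n → List (Word k n)
  vecs k zero    = [] ∷ []
  vecs k (suc n) = cartesianProductWith _∷_ (allFin k) (vecs k n)

  vecs-unique : ∀ k n → Unique (vecs k n)
  vecs-unique k zero    = [] ∷ []
  vecs-unique k (suc n) = Unique.cartesianProductWith⁺ _∷_ Vec.∷-injective (Unique.allFin⁺ k) (vecs-unique k n)

  ∑-vecs : ∀ {k} n (f : List (Fin k) → ℕ) → ∑ (vecs k n) (f ∘ toList) ≡ ∑ (words k n) f
  ∑-vecs     zero    f = refl
  ∑-vecs {k} (suc n) f = trans (∑-product _∷_ (allFin k) (vecs k n) (f ∘ toList))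
    (trans (∑-cong (allFin k) (λ {a} _ → ∑-vecs n (λ w → f (a ∷ w)))) (sym (∑-words-suc n f)))

  length-vecs : ∀ k n → length (vecs k n) ≡ k ^ n
  length-vecs k n = trans (sym (trans (∑-const 1 (vecs k n)) (*-identityʳ _)))
    (trans (∑-vecs {k} n (λ _ → 1)) (trans (∑-words-const k n 1) (*-identityʳ _)))

  length-filter-¬ : {A : Set} {P : A → Set} (P? : ∀ x → Dec (P x)) (xs : List A) →
    length xs ≡ length (filter (¬? ∘ P?) xs) + ∑ xs (ind ∘ P?)
  length-filter-¬ P? []       = refl
  length-filter-¬ P? (x ∷ xs) with P? x
  ... | yes _ = trans (cong suc (length-filter-¬ P? xs)) (sym (+-suc _ _))
  ... | no _  = cong suc (length-filter-¬ P? xs)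

  -- Fractions and the product formula

  -- `ratio` reduces to lowest terms, which hides `a` and `b`; the cross-multiplication is therefore
  -- done on unnormalised rationals.
  ratio-≤ : ∀ a b c d .⦃ _ : ℕ.NonZero b ⦄ .⦃ _ : ℕ.NonZero d ⦄ → a * d ≤ c * b → ratio a b ℚ.≤ ratio c d
  ratio-≤ a (suc b) c (suc d) h = ℚ.toℚᵘ-cancel-≤ (ℚᵘ.≤-trans (ℚᵘ.≤-reflexive (ℚ.toℚᵘ-fromℚᵘ (mkℚᵘ (ℤ.+ a) b)))
    (ℚᵘ.≤-trans (*≤* (subst₂ ℤ._≤_ (ℤ.pos-* a (suc d)) (ℤ.pos-* c (suc b)) (ℤ.+≤+ h)))
      (ℚᵘ.≤-reflexive (ℚᵘ.≃-sym (ℚ.toℚᵘ-fromℚᵘ (mkℚᵘ (ℤ.+ c) d))))))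

  ratio-cong : ∀ a b c d .⦃ _ : ℕ.NonZero b ⦄ .⦃ _ : ℕ.NonZero d ⦄ → a * d ≡ c * b → ratio a b ≡ ratio c d
  ratio-cong a b c d h = ℚ.≤-antisym (ratio-≤ a b c d (≤-reflexive h)) (ratio-≤ c d a b (≤-reflexive (sym h)))

  ratio-* : ∀ a b c d .⦃ _ : ℕ.NonZero b ⦄ .⦃ _ : ℕ.NonZero d ⦄ → ratio a b ℚ.* ratio c d ≡ ratio (a * c) (b * d)
  ratio-* a (suc b) c (suc d) = ℚ.toℚᵘ-injective (ℚᵘ.≃-trans (ℚ.toℚᵘ-homo-* (ratio a (suc b)) (ratio c (suc d)))
    (ℚᵘ.≃-trans (ℚᵘ.*-cong (ℚ.toℚᵘ-fromℚᵘ (mkℚᵘ (ℤ.+ a) b)) (ℚ.toℚᵘ-fromℚᵘ (mkℚᵘ (ℤ.+ c) d)))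
    (ℚᵘ.≃-trans (ℚᵘ.≃-reflexive (cong (λ n → mkℚᵘ n (d + b * suc d)) (sym (ℤ.pos-* a c))))
      (ℚᵘ.≃-sym (ℚ.toℚᵘ-fromℚᵘ (mkℚᵘ (ℤ.+ (a * c)) (d + b * suc d)))))))

  ratio-+ : ∀ a b c d .⦃ _ : ℕ.NonZero b ⦄ .⦃ _ : ℕ.NonZero d ⦄ →
    ratio a b ℚ.+ ratio c d ≡ ratio (a * d + c * b) (b * d)
  ratio-+ a (suc b) c (suc d) = ℚ.toℚᵘ-injective (ℚᵘ.≃-trans (ℚ.toℚᵘ-homo-+ (ratio a (suc b)) (ratio c (suc d)))
    (ℚᵘ.≃-trans (ℚᵘ.+-cong (ℚ.toℚᵘ-fromℚᵘ (mkℚᵘ (ℤ.+ a) b)) (ℚ.toℚᵘ-fromℚᵘ (mkℚᵘ (ℤ.+ c) d)))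
    (ℚᵘ.≃-trans (ℚᵘ.≃-reflexive (cong (λ n → mkℚᵘ n (d + b * suc d))
        (trans (cong₂ ℤ._+_ (sym (ℤ.pos-* a (suc d))) (sym (ℤ.pos-* c (suc b)))) (sym (ℤ.pos-+ (a * suc d) (c * suc b))))))
      (ℚᵘ.≃-sym (ℚ.toℚᵘ-fromℚᵘ (mkℚᵘ (ℤ.+ (a * suc d + c * suc b)) (d + b * suc d)))))))

  -- numer r d / denom r d is the slope Π_{r,k} / k for k = r + d, in the unreduced form the recursion produces.
  numer denom : ℕ → ℕ → ℕ
  numer r zero    = 1
  numer r (suc d) = numer r d * (r + d) * suc (r + d) ^ r
  denom r zero    = r
  denom r (suc d) = denom r d * suc (r + d) * (suc (r + d) ^ r ∸ 1)

  top bot : ℕ → ℕ → ℕ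
  top r zero    = 1
  top r (suc d) = top r d * suc (r + d) ^ r
  bot r zero    = 1
  bot r (suc d) = bot r d * (suc (r + d) ^ r ∸ 1)

  -- The cross-multiplied form of `numer / denom = (top / bot) / (r + d)`: the factors k / (k + 1)
  -- carry the initial 1 / r to 1 / (r + d).
  telescope : ∀ r d → top r d * denom r d ≡ numer r d * bot r d * (r + d)
  telescope r zero    = alg r
    where
    alg : ∀ r → 1 * r ≡ 1 * 1 * (r + 0)
    alg = solve-∀
  telescope r (suc d) = begin
    top r d * Kʳ * (denom r d * K * g)                      ≡⟨ alg₁ (top r d) Kʳ (denom r d) K g ⟩
    top r d * denom r d * (Kʳ * K * g)                      ≡⟨ cong₂ (λ x y → x * (Kʳ * y * g)) (telescope r d) (sym (+-suc r d)) ⟩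
    numer r d * bot r d * (r + d) * (Kʳ * (r + suc d) * g)  ≡⟨ alg₂ (numer r d) (bot r d) (r + d) Kʳ (r + suc d) g ⟩
    numer r d * (r + d) * Kʳ * (bot r d * g) * (r + suc d)  ∎
    where
    open ≡-Reasoning
    K  = suc (r + d)
    Kʳ = suc (r + d) ^ r
    g  = suc (r + d) ^ r ∸ 1
    alg₁ : ∀ t κ e K g → t * κ * (e * K * g) ≡ t * e * (κ * K * g)
    alg₁ = solve-∀
    alg₂ : ∀ n b k κ K g → n * b * k * (κ * K * g) ≡ n * k * κ * (b * g) * K
    alg₂ = solve-∀

  1≤kʳ∸1 : ∀ k r → 2 ≤ k → 1 ≤ r → 1 ≤ k ^ r ∸ 1
  1≤kʳ∸1 (suc (suc k)) (suc r) (s≤s (s≤s z≤n)) _ = ∸-monoˡ-≤ 1 (≤-trans (s≤s (s≤s z≤n))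
    (m≤m*n (suc (suc k)) (suc (suc k) ^ r) ⦃ m^n≢0 (suc (suc k)) r ⦄))

  bot>0 : ∀ r d → 1 ≤ r → 1 ≤ bot r d
  bot>0 r zero    1≤r = ≤-refl
  bot>0 r (suc d) 1≤r = *-mono-≤ (bot>0 r d 1≤r) (1≤kʳ∸1 (suc (r + d)) r (s≤s (≤-trans 1≤r (m≤m+n r d))) 1≤r)

  denom>0 : ∀ r d → 1 ≤ r → 1 ≤ denom r d
  denom>0 r zero    1≤r = 1≤r
  denom>0 r (suc d) 1≤r = *-mono-≤ (*-mono-≤ (denom>0 r d 1≤r) (s≤s (z≤n {r + d}))) (1≤kʳ∸1 (suc (r + d)) r (s≤s (≤-trans 1≤r (m≤m+n r d))) 1≤r)

  numer>0 : ∀ r d → 1 ≤ r → 1 ≤ numer r d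
  numer>0 r zero    1≤r = ≤-refl
  numer>0 r (suc d) 1≤r = *-mono-≤ (*-mono-≤ (numer>0 r d 1≤r) (≤-trans 1≤r (m≤m+n r d))) (m^n>0 (suc (r + d)) r)

  foldr-* : ∀ x ys → foldr ℚ._*_ x ys ≡ foldr ℚ._*_ 1ℚ ys ℚ.* x
  foldr-* x []       = sym (ℚ.*-identityˡ x)
  foldr-* x (y ∷ ys) = trans (cong (y ℚ.*_) (foldr-* x ys)) (sym (ℚ.*-assoc y (foldr ℚ._*_ 1ℚ ys) x))

  -- The foldr is the one in the definition of Π.
  Π-top-bot : ∀ r d → 1 ≤ r →
    foldr ℚ._*_ 1ℚ (map (λ i → ratio (suc (r + i) ^ r) (suc (r + i) ^ r ∸ 1)) (upTo d)) ≡ ratio (top r d) (bot r d)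
  Π-top-bot r zero    1≤r = refl
  Π-top-bot r (suc d) 1≤r = begin
    foldr ℚ._*_ 1ℚ (map F (upTo (suc d)))                 ≡⟨ cong (foldr ℚ._*_ 1ℚ ∘ map F) (sym (upTo-∷ʳ d)) ⟩
    foldr ℚ._*_ 1ℚ (map F (upTo d ∷ʳ d))                  ≡⟨ cong (foldr ℚ._*_ 1ℚ) (map-++ F (upTo d) (d ∷ [])) ⟩
    foldr ℚ._*_ 1ℚ (map F (upTo d) ∷ʳ F d)                ≡⟨ foldr-∷ʳ ℚ._*_ 1ℚ (F d) (map F (upTo d)) ⟩
    foldr ℚ._*_ (F d ℚ.* 1ℚ) (map F (upTo d))             ≡⟨ foldr-* (F d ℚ.* 1ℚ) (map F (upTo d)) ⟩
    foldr ℚ._*_ 1ℚ (map F (upTo d)) ℚ.* (F d ℚ.* 1ℚ)      ≡⟨ cong₂ ℚ._*_ (Π-top-bot r d 1≤r) (ℚ.*-identityʳ (F d)) ⟩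
    ratio (top r d) (bot r d) ℚ.* F d                     ≡⟨ mul (bot r d) (suc (r + d) ^ r ∸ 1) (bot>0 r d 1≤r) (1≤kʳ∸1 (suc (r + d)) r (s≤s (≤-trans 1≤r (m≤m+n r d))) 1≤r) ⟩
    ratio (top r (suc d)) (bot r (suc d))                 ∎
    where
    open ≡-Reasoning
    F : ℕ → ℚ
    F i = ratio (suc (r + i) ^ r) (suc (r + i) ^ r ∸ 1)
    mul : ∀ b g → 1 ≤ b → 1 ≤ g → ratio (top r d) b ℚ.* ratio (suc (r + d) ^ r) g ≡ ratio (top r d * suc (r + d) ^ r) (b * g)
    mul (suc b) (suc g) _ _ = ratio-* (top r d) (suc b) (suc (r + d) ^ r) (suc g)

  Π-ratio : ∀ r d n → 1 ≤ r → Π r (r + d) ℚ.* ratio n (r + d) ≡ ratio (numer r d * n) (denom r d)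
  Π-ratio r d n 1≤r rewrite m+n∸m≡n r d | Π-top-bot r d 1≤r =
    go (bot r d) (r + d) (denom r d) (bot>0 r d 1≤r) (≤-trans 1≤r (m≤m+n r d)) (denom>0 r d 1≤r) (telescope r d)
    where
    go : ∀ b k e → 1 ≤ b → 1 ≤ k → 1 ≤ e → top r d * e ≡ numer r d * b * k →
      ratio (top r d) b ℚ.* ratio n k ≡ ratio (numer r d * n) e
    go (suc b) (suc k) (suc e) _ _ _ eq = trans (ratio-* (top r d) (suc b) n (suc k))
      (ratio-cong (top r d * n) (suc b * suc k) (numer r d * n) (suc e)
        (trans (alg₁ (top r d) n (suc e)) (trans (cong (n *_) eq) (alg₂ (numer r d) n (suc b) (suc k)))))
      where
      alg₁ : ∀ t n e → t * n * e ≡ n * (t * e)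
      alg₁ = solve-∀
      alg₂ : ∀ m n b k → n * (m * b * k) ≡ m * n * (b * k)
      alg₂ = solve-∀

  -- From average length to almost all words

  cube : ℕ → ℕ
  cube m = m * m * m

  -- The cubes are the loss of the base case; a new letter multiplies the slope exactly and adds no
  -- further loss.
  density-all : ∀ r₀ m d → Density (suc r₀) (suc r₀ + d) (cube m * numer (suc r₀) d) (cube (suc m) * denom (suc r₀) d)
  density-all r₀ m zero = subst₂ (λ k P → Density (suc r₀) k P (cube (suc m) * suc r₀))
    (sym (+-identityʳ (suc r₀))) (sym (*-identityʳ (cube m))) (Base.density r₀ m)
  density-all r₀ m (suc d) = subst (λ k → Density r k (cube m * numer r (suc d)) (cube (suc m) * denom r (suc d)))
    (sym (+-suc r d))
    (subst₂ (Density r (suc (r + d))) (alg (cube m) (numer r d) (r + d) (suc (r + d) ^ r))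
      (alg (cube (suc m)) (denom r d) (suc (r + d)) (suc (r + d) ^ r ∸ 1)) (density-new-letter {P = cube m * numer r d} {Q = cube (suc m) * denom r d} (density-all r₀ m d)))
    where
    r = suc r₀
    alg : ∀ a b c d → a * b * c * d ≡ a * (b * c * d)
    alg = solve-∀

  -- Three more factors m / (m + 1): the additive constant `D` (`mean`), the deviation allowed by
  -- the weak law, and the letters after the last block (`fraction`).
  typical : ∀ {r k P Q} m → Density r (suc k) P Q → 1 ≤ P → 1 ≤ m → ∃ λ n₀ → ∀ n → n₀ ≤ n →
    Σ (List (Fin (suc k)) → ℕ) λ Z → (∀ w → HasTwins r w (Z w)) ×
      suc m * ∑ (words (suc k) n) (λ w → ind (cube (suc m) * Q * Z w <? cube m * P * n)) ≤ suc k ^ n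
  typical {r} {k′} {P} {Q} m (X , X-twins , D , X-bound) 1≤P 1≤m =
    -- `J₀` blocks are needed for the weak law, and `m` blocks make the tail at most 1 / (m + 1) of
    -- the word.
    (J₀ + m) * L , λ n n₀≤n → blockSum L X (n / L) , hasTwins-blockSum L X-twins (n / L) ,
      few n (n / L) (n % L) (n≡ n) (<⇒≤ (m%n<n n L)) (J₀+m≤ n n₀≤n)
    where
    open ≤-Reasoning
    k M L T N : ℕ
    k = suc k′
    M = suc m
    -- So long that the loss `D` is at most the share 1 / (m + 1) of `P * L`.
    L = suc (M * D)
    T = ∑ (words k L) X
    N = k ^ L
    bad : ℕ → ℕ → List (Fin k) → ℕ
    bad n J w = ind (cube M * Q * blockSum L X J w <? cube m * P * n)
    mean : m * (P * L * N) ≤ M * (Q * T)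
    mean = +-cancelʳ-≤ (P * L * N) _ _ (begin
      m * (P * L * N) + P * L * N          ≡⟨ +-comm (m * (P * L * N)) _ ⟩
      M * (P * L * N)                      ≤⟨ *-monoʳ-≤ M (X-bound L) ⟩
      M * (Q * T + D * N)                  ≡⟨ alg M Q T D N ⟩
      M * (Q * T) + M * D * N              ≤⟨ +-monoʳ-≤ (M * (Q * T)) (*-monoˡ-≤ N (≤-trans (n≤1+n (M * D)) (m≤n*m L P ⦃ ℕ.>-nonZero 1≤P ⦄))) ⟩
      M * (Q * T) + P * L * N              ∎)
      where
      alg : ∀ M Q T D N → M * (Q * T + D * N) ≡ M * (Q * T) + M * D * N
      alg = solve-∀
    1≤T : 1 ≤ T
    1≤T with T | mean
    ... | suc _ | _ = s≤s z≤n
    ... | zero  | p with ≤-trans (*-mono-≤ 1≤m (*-mono-≤ (*-mono-≤ 1≤P (s≤s (z≤n {M * D}))) (m^n>0 k L))) (≤-trans p (≤-reflexive (trans (cong (M *_) (*-zeroʳ Q)) (*-zeroʳ M))))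
    ...   | ()
    law : ∀ ρ → ∃ λ M₀ → ∀ J → M₀ ≤ J →
      M * ∑ (words k (J * L + ρ)) (λ w → ind (suc m * (k ^ L * blockSum L X J w) <? m * (J * ∑ (words k L) X))) ≤ k ^ (J * L + ρ)
    law ρ = weakLaw k L ρ X m M 1≤T
    J₀ : ℕ
    -- The threshold of `weakLaw` is the same for every tail length, so `law 0` speaks for all `ρ`.
    J₀ = proj₁ (law 0)
    n≡ : ∀ n → n ≡ n / L * L + n % L
    n≡ n = trans (m≡m%n+[m/n]*n n L) (+-comm (n % L) (n / L * L))
    J₀+m≤ : ∀ n → (J₀ + m) * L ≤ n → J₀ + m ≤ n / L
    J₀+m≤ n h = ≤-trans (≤-reflexive (sym (m*n/n≡m (J₀ + m) L))) (/-monoˡ-≤ L h)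
    few : ∀ n J ρ → n ≡ J * L + ρ → ρ ≤ L → J₀ + m ≤ J → M * ∑ (words k n) (bad n J) ≤ k ^ n
    few n J ρ refl ρ≤L J≥ = ≤-trans
      (*-monoʳ-≤ M (∑-mono (words k n) (λ {w} _ → ind-mono (worse w) _ _)))
      (proj₂ (law ρ) J (≤-trans (m≤m+n J₀ m) J≥))
      where
      fraction : m * n ≤ M * (J * L)
      fraction = begin
        m * (J * L + ρ)          ≡⟨ *-distribˡ-+ m (J * L) ρ ⟩
        m * (J * L) + m * ρ      ≤⟨ +-monoʳ-≤ (m * (J * L)) (*-mono-≤ (≤-trans (m≤n+m m J₀) J≥) ρ≤L) ⟩
        m * (J * L) + J * L      ≡⟨ +-comm (m * (J * L)) (J * L) ⟩
        M * (J * L)              ∎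
      worse : ∀ w → cube M * Q * blockSum L X J w < cube m * P * n → M * (N * blockSum L X J w) < m * (J * T)
      worse w lt = ≰⇒> λ mJT≤ → <-irrefl refl (≤-trans lt (*-cancelˡ-≤ N ⦃ m^n≢0 k L ⦄ (begin
        N * (cube m * P * n)               ≡⟨ alg₁ N m P n ⟩
        N * (m * m * P) * (m * n)          ≤⟨ *-monoʳ-≤ (N * (m * m * P)) fraction ⟩
        N * (m * m * P) * (M * (J * L))    ≡⟨ alg₂ N m P M J L ⟩
        M * m * J * (m * (P * L * N))      ≤⟨ *-monoʳ-≤ (M * m * J) mean ⟩
        M * m * J * (M * (Q * T))          ≡⟨ alg₃ M m J Q T ⟩
        M * M * Q * (m * (J * T))          ≤⟨ *-monoʳ-≤ (M * M * Q) mJT≤ ⟩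
        M * M * Q * (M * (N * z))          ≡⟨ alg₄ M Q N z ⟩
        N * (cube M * Q * z)               ∎)))
        where
        z = blockSum L X J w
        alg₁ : ∀ N m P n → N * (m * m * m * P * n) ≡ N * (m * m * P) * (m * n)
        alg₁ = solve-∀
        alg₂ : ∀ N m P M J L → N * (m * m * P) * (M * (J * L)) ≡ M * m * J * (m * (P * L * N))
        alg₂ = solve-∀
        alg₃ : ∀ M m J Q T → M * m * J * (M * (Q * T)) ≡ M * M * Q * (m * (J * T))
        alg₃ = solve-∀
        alg₄ : ∀ M Q N z → M * M * Q * (M * (N * z)) ≡ N * (M * M * M * Q * z)
        alg₄ = solve-∀

  -- Bernoulli's inequality (m / (m + 1))⁶ ≥ 1 - 6 / (m + 1); the added polynomial is the exact
  -- difference of the two sides.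
  bernoulli : ∀ m → cube (suc m) * cube (suc m) ≤ cube m * cube m + 6 * (cube (suc m) * (suc m * suc m))
  bernoulli m = ≤-trans (m≤m+n _ (15 * (cube m * m) + 40 * cube m + 45 * (m * m) + 24 * m + 5)) (≤-reflexive (alg m))
    where
    alg : ∀ m → (1 + m) * (1 + m) * (1 + m) * ((1 + m) * (1 + m) * (1 + m)) + (15 * (m * m * m * m) + 40 * (m * m * m) + 45 * (m * m) + 24 * m + 5)
      ≡ m * m * m * (m * m * m) + 6 * ((1 + m) * (1 + m) * (1 + m) * ((1 + m) * (1 + m)))
    alg = solve-∀

  Good : ℕ → ℕ → ℕ → ℕ → Set
  Good r d M n = Σ (List (Word (r + d) n)) λ ws → Unique ws ×
    All (λ w → ∀ t → IsMaxTwinLength r w t → M * (numer r d * n) ≤ M * (denom r d * t) + 6 * (numer r d * n)) ws ×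
    M * (r + d) ^ n ≤ M * length ws + (r + d) ^ n

  eventually-good : ∀ r₀ d m → 1 ≤ m → ∃ λ n₀ → ∀ n → n₀ ≤ n → Good (suc r₀) d (suc m) n
  eventually-good r₀ d m 1≤m
    with typical {P = cube m * numer (suc r₀) d} {Q = cube (suc m) * denom (suc r₀) d} m (density-all r₀ m d)
           (*-mono-≤ (*-mono-≤ (*-mono-≤ 1≤m 1≤m) 1≤m) (numer>0 (suc r₀) d (s≤s z≤n))) 1≤m
  ... | n₀ , h = n₀ , λ n n₀≤n → good n (h n n₀≤n)
    where
    r = suc r₀
    k = r + d
    M = suc m
    num = numer r d
    den = denom r d
    good : ∀ n → (Σ (List (Fin k) → ℕ) λ Z → (∀ w → HasTwins r w (Z w)) ×
      M * ∑ (words k n) (λ w → ind (cube M * (cube M * den) * Z w <? cube m * (cube m * num) * n)) ≤ k ^ n) → Good r d M n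
    good n (Z , Z-twins , few) = filter (¬? ∘ bad?) (vecs k n) , Unique.filter⁺ (¬? ∘ bad?) (vecs-unique k n) ,
      All.map (λ {w} → long w) (All.all-filter (¬? ∘ bad?) (vecs k n)) , many
      where
      open ≤-Reasoning
      bad? : (w : Word k n) → Dec (cube M * (cube M * den) * Z (toList w) < cube m * (cube m * num) * n)
      bad? w = cube M * (cube M * den) * Z (toList w) <? cube m * (cube m * num) * n
      long : ∀ w → ¬ (cube M * (cube M * den) * Z (toList w) < cube m * (cube m * num) * n) →
        ∀ t → IsMaxTwinLength r w t → M * (num * n) ≤ M * (den * t) + 6 * (num * n)
      long w ¬bad t isMax = *-cancelˡ-≤ (cube M * (M * M)) (begin
        cube M * (M * M) * (M * (num * n))                                      ≡⟨ alg₁ M (num * n) ⟩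
        cube M * cube M * (num * n)                                             ≤⟨ *-monoˡ-≤ (num * n) (bernoulli m) ⟩
        (cube m * cube m + 6 * (cube M * (M * M))) * (num * n)                  ≡⟨ alg₂ (cube m) (cube M * (M * M)) num n ⟩
        cube m * (cube m * num) * n + 6 * (cube M * (M * M)) * (num * n)        ≤⟨ +-monoˡ-≤ _ (≮⇒≥ ¬bad) ⟩
        cube M * (cube M * den) * Z (toList w) + 6 * (cube M * (M * M)) * (num * n)
          ≤⟨ +-monoˡ-≤ _ (*-monoʳ-≤ (cube M * (cube M * den)) (hasTwins-≤-max w (Z-twins (toList w)) isMax)) ⟩
        cube M * (cube M * den) * t + 6 * (cube M * (M * M)) * (num * n)        ≡⟨ alg₃ M den t (num * n) ⟩
        cube M * (M * M) * (M * (den * t) + 6 * (num * n))                      ∎)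
        where
        alg₁ : ∀ M x → M * M * M * (M * M) * (M * x) ≡ M * M * M * (M * M * M) * x
        alg₁ = solve-∀
        alg₂ : ∀ c e p n → (c * c + 6 * e) * (p * n) ≡ c * (c * p) * n + 6 * e * (p * n)
        alg₂ = solve-∀
        alg₃ : ∀ M d t x → M * M * M * (M * M * M * d) * t + 6 * (M * M * M * (M * M)) * x ≡ M * M * M * (M * M) * (M * (d * t) + 6 * x)
        alg₃ = solve-∀
      many : M * k ^ n ≤ M * length (filter (¬? ∘ bad?) (vecs k n)) + k ^ n
      many = begin
        M * k ^ n
          ≡⟨ cong (M *_) (sym (length-vecs k n)) ⟩
        M * length (vecs k n)
          ≡⟨ cong (M *_) (length-filter-¬ bad? (vecs k n)) ⟩
        M * (length (filter (¬? ∘ bad?) (vecs k n)) + ∑ (vecs k n) (ind ∘ bad?))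
          ≡⟨ *-distribˡ-+ M (length (filter (¬? ∘ bad?) (vecs k n))) _ ⟩
        M * length (filter (¬? ∘ bad?) (vecs k n)) + M * ∑ (vecs k n) (ind ∘ bad?)
          ≡⟨ cong (λ s → M * length (filter (¬? ∘ bad?) (vecs k n)) + M * s) (∑-vecs n _) ⟩
        M * length (filter (¬? ∘ bad?) (vecs k n)) + M * ∑ (words k n) (λ w → ind (cube M * (cube M * den) * Z w <? cube m * (cube m * num) * n))
          ≤⟨ +-monoʳ-≤ (M * length (filter (¬? ∘ bad?) (vecs k n))) few ⟩
        M * length (filter (¬? ∘ bad?) (vecs k n)) + k ^ n ∎

  -- Diagonal choice of the error function

  -- The largest j ≤ b with N j ≤ n, shifted by one (0 if there is none).
  level : (ℕ → ℕ) → ℕ → ℕ → ℕ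
  level N n zero    = 0
  level N n (suc j) with N j ≤? n
  ... | yes _ = suc j
  ... | no _  = level N n j

  level-sound : ∀ N n b j → level N n b ≡ suc j → N j ≤ n
  level-sound N n (suc b) j eq with N b ≤? n
  level-sound N n (suc b) j refl | yes Nb≤n = Nb≤n
  level-sound N n (suc b) j eq   | no _     = level-sound N n b j eq

  level-≥ : ∀ N n b j → j < b → N j ≤ n → suc j ≤ level N n b
  level-≥ N n (suc b) j j<b Nj≤n with N b ≤? n | m≤n⇒m<n∨m≡n (≤-pred j<b)
  ... | yes _ | _          = j<b
  ... | no _  | inj₁ j<b′  = level-≥ N n b j j<b′ Nj≤n
  ... | no ¬p | inj₂ refl  = ⊥-elim (¬p Nj≤n)

  reciprocal-≤ : ∀ ε → 0ℚ ℚ.< ε → ∃ λ e → ratio 1 (suc e) ℚ.≤ ε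
  reciprocal-≤ (mkℚ (ℤ.+ zero) d c)  (ℚ.*<* (ℤ.+<+ ()))
  reciprocal-≤ (mkℚ ℤ.-[1+ n ] d c)  (ℚ.*<* ())
  -- Here ε = (n + 1) / (d + 1), which is at least 1 / (d + 1).
  reciprocal-≤ (mkℚ (ℤ.+ suc n) d c) 0<ε = d , subst (ratio 1 (suc d) ℚ.≤_) (ℚ.fromℚᵘ-toℚᵘ (mkℚ (ℤ.+ suc n) d c))
    (ratio-≤ 1 (suc d) (suc n) (suc d) (*-monoˡ-≤ (suc d) (s≤s (z≤n {n}))))

  p≤q+s⇒p-s≤q : ∀ p q s → p ℚ.≤ q ℚ.+ s → p - s ℚ.≤ q
  p≤q+s⇒p-s≤q p q s h = ℚ.≤-trans (ℚ.+-monoˡ-≤ (ℚ.- s) h) (ℚ.≤-reflexive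
    (trans (ℚ.+-assoc q s (ℚ.- s)) (trans (cong (q ℚ.+_) (ℚ.+-inverseʳ s)) (ℚ.+-identityʳ q))))

  0≤ratio : ∀ a b → 0ℚ ℚ.≤ ratio a b
  0≤ratio a zero    = ℚ.≤-refl
  0≤ratio a (suc b) = ratio-≤ 0 1 a (suc b) z≤n

  -- The conclusion as a predicate of `k`, to be transported along `r + (k ∸ r) ≡ k`.
  AsymptoticBound : ℕ → ℕ → Set
  AsymptoticBound r k = Σ (ℕ → ℚ) λ f →
    (∀ ε → 0ℚ ℚ.< ε → ∃ λ n₀ → ∀ n → n₀ ≤ n → ∣ f n ∣ ℚ.≤ ε ℚ.* ratio n 1)
    × (∀ ε → 0ℚ ℚ.< ε → ∃ λ n₀ → ∀ n → n₀ ≤ n →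
        Σ (List (Word k n)) λ ws → Unique ws
          × All (λ w → ∀ t → IsMaxTwinLength r w t → Π r k ℚ.* ratio n k - f n ℚ.≤ ratio t 1) ws
          × (1ℚ - ε) ℚ.* ratio (k ^ n) 1 ℚ.≤ ratio (length ws) 1)

  module Diagonal (r₀ d : ℕ) where
    r : ℕ
    r = suc r₀

    N : ℕ → ℕ
    N j = proj₁ (eventually-good r₀ d (suc j) (s≤s z≤n))

    -- For n in stage M = suc (level n), at most a proportion 1 / M of words is lost, and at most 6 / M of the length.
    stage : ℕ → ℕ
    stage n = suc (level N n n)

    -- The search for the level of `n` runs below `n`, hence `suc j ≤ n` is required besides
    -- `N j ≤ n`.
    stage-≥ : ∀ j n → suc j ⊔ N j ≤ n → suc (suc j) ≤ stage n
    stage-≥ j n n≥ = s≤s (level-≥ N n n j (m⊔n≤o⇒m≤o (suc j) (N j) n≥) (m⊔n≤o⇒n≤o (suc j) (N j) n≥))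

    good : ∀ n → 2 ≤ stage n → Good r d (stage n) n
    good n 2≤ with level N n n in eq
    -- Level 0 means that no threshold was found; the stage is then 1, against `2 ≤ stage n`.
    good n (s≤s ()) | zero
    ... | suc j = proj₂ (eventually-good r₀ d (suc j) (s≤s z≤n)) n (level-sound N n n j eq)

    error : ℕ → ℚ
    error n = ratio (6 * (numer r d * n)) (denom r d * stage n)

    error-small : ∀ ε → 0ℚ ℚ.< ε → ∃ λ n₀ → ∀ n → n₀ ≤ n → ∣ error n ∣ ℚ.≤ ε ℚ.* ratio n 1
    error-small ε 0<ε with reciprocal-≤ ε 0<ε
    ... | e , e≤ε = suc j ⊔ N j , λ n n≥ → begin
      ∣ error n ∣                          ≡⟨ ℚ.0≤p⇒∣p∣≡p (0≤ratio _ (denom r d * stage n)) ⟩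
      error n                              ≤⟨ small n (denom r d) (denom>0 r d (s≤s z≤n)) (≤-trans (≤-trans (n≤1+n j) (n≤1+n (suc j))) (stage-≥ j n n≥)) ⟩
      ratio 1 (suc e) ℚ.* ratio n 1        ≤⟨ ℚ.*-monoʳ-≤-nonNeg (ratio n 1) ⦃ ℚ.nonNegative (0≤ratio n 1) ⦄ e≤ε ⟩
      ε ℚ.* ratio n 1                      ∎
      where
      open ℚ.≤-Reasoning
      -- Chosen so that `stage n ≥ j` makes the error at most `n / (e + 1)`.
      j = 6 * numer r d * suc e
      small : ∀ n den → 1 ≤ den → j ≤ stage n → ratio (6 * (numer r d * n)) (den * stage n) ℚ.≤ ratio 1 (suc e) ℚ.* ratio n 1
      small n (suc den) _ j≤ = subst (ratio (6 * (numer r d * n)) (suc den * stage n) ℚ.≤_) (sym (ratio-* 1 (suc e) n 1))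
        (ratio-≤ (6 * (numer r d * n)) (suc den * stage n) (1 * n) (suc e * 1) (≤-trans (≤-reflexive (alg₁ (numer r d) n (suc e)))
          (≤-trans (*-monoʳ-≤ n (≤-trans j≤ (m≤n*m (stage n) (suc den)))) (≤-reflexive (alg₂ n (suc den * stage n))))))
        where
        alg₁ : ∀ p n e → 6 * (p * n) * (e * 1) ≡ n * (6 * p * e)
        alg₁ = solve-∀
        alg₂ : ∀ n x → n * x ≡ 1 * n * x
        alg₂ = solve-∀

    long : ∀ n t → stage n * (numer r d * n) ≤ stage n * (denom r d * t) + 6 * (numer r d * n) →
      Π r (r + d) ℚ.* ratio n (r + d) - error n ℚ.≤ ratio t 1
    long n t h = p≤q+s⇒p-s≤q _ (ratio t 1) (error n)
      (subst (ℚ._≤ ratio t 1 ℚ.+ error n) (sym (Π-ratio r d n (s≤s z≤n))) (go (denom r d) (denom>0 r d (s≤s z≤n)) h))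
      where
      go : ∀ den → 1 ≤ den → stage n * (numer r d * n) ≤ stage n * (den * t) + 6 * (numer r d * n) →
        ratio (numer r d * n) den ℚ.≤ ratio t 1 ℚ.+ ratio (6 * (numer r d * n)) (den * stage n)
      go (suc den) _ h = subst (ratio (numer r d * n) (suc den) ℚ.≤_) (sym (ratio-+ t 1 (6 * (numer r d * n)) (suc den * stage n)))
        (ratio-≤ (numer r d * n) (suc den) (t * (suc den * stage n) + 6 * (numer r d * n) * 1) (1 * (suc den * stage n)) (≤-trans (≤-reflexive (alg₁ (numer r d * n) (suc den) (stage n)))
          (≤-trans (*-monoˡ-≤ (suc den) h) (≤-reflexive (alg₂ (stage n) (suc den) t (6 * (numer r d * n)))))))
        where
        alg₁ : ∀ x e M → x * (1 * (e * M)) ≡ M * x * e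
        alg₁ = solve-∀
        alg₂ : ∀ M e t y → (M * (e * t) + y) * e ≡ (t * (e * M) + y * 1) * e
        alg₂ = solve-∀

    many : ∀ ε e K l M → ratio 1 (suc e) ℚ.≤ ε → suc e ≤ M → M * K ≤ M * l + K → (1ℚ - ε) ℚ.* ratio K 1 ℚ.≤ ratio l 1
    many ε e K l M e≤ε e≤M h = begin
      (1ℚ - ε) ℚ.* ratio K 1
        ≤⟨ ℚ.*-monoʳ-≤-nonNeg (ratio K 1) ⦃ ℚ.nonNegative (0≤ratio K 1) ⦄ (ℚ.+-monoʳ-≤ 1ℚ (ℚ.neg-antimono-≤ e≤ε)) ⟩
      (1ℚ - δ) ℚ.* ratio K 1
        ≡⟨ ℚ.*-distribʳ-+ (ratio K 1) 1ℚ (ℚ.- δ) ⟩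
      1ℚ ℚ.* ratio K 1 ℚ.+ (ℚ.- δ) ℚ.* ratio K 1
        ≡⟨ cong₂ ℚ._+_ (ℚ.*-identityˡ (ratio K 1)) (sym (ℚ.neg-distribˡ-* δ (ratio K 1))) ⟩
      ratio K 1 - δ ℚ.* ratio K 1
        ≤⟨ p≤q+s⇒p-s≤q (ratio K 1) (ratio l 1) (δ ℚ.* ratio K 1) (subst (ratio K 1 ℚ.≤_) (sym rational-sum) count-≤) ⟩
      ratio l 1 ∎
      where
      open ℚ.≤-Reasoning
      δ = ratio 1 (suc e)
      rational-sum : ratio l 1 ℚ.+ δ ℚ.* ratio K 1 ≡ ratio (l * (suc e * 1) + 1 * K * 1) (1 * (suc e * 1))
      rational-sum = trans (cong (ratio l 1 ℚ.+_) (ratio-* 1 (suc e) K 1)) (ratio-+ l 1 (1 * K) (suc e * 1))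
      count-≤ : ratio K 1 ℚ.≤ ratio (l * (suc e * 1) + 1 * K * 1) (1 * (suc e * 1))
      count-≤ = ratio-≤ K 1 (l * (suc e * 1) + 1 * K * 1) (1 * (suc e * 1)) (*-cancelˡ-≤ M ⦃ ℕ.>-nonZero (≤-trans (s≤s z≤n) e≤M) ⦄ (≤-trans (≤-reflexive (alg₁ M K (suc e)))
        (≤-trans (*-monoʳ-≤ (suc e) h) (≤-trans (≤-reflexive (*-distribˡ-+ (suc e) (M * l) K))
          (≤-trans (+-monoʳ-≤ (suc e * (M * l)) (*-monoˡ-≤ K e≤M)) (≤-reflexive (alg₂ M l K (suc e))))))))
        where
        alg₁ : ∀ M K e → M * (K * (1 * (e * 1))) ≡ e * (M * K)
        alg₁ = solve-∀
        alg₂ : ∀ M l K e → e * (M * l) + M * K ≡ M * ((l * (e * 1) + 1 * K * 1) * 1)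
        alg₂ = solve-∀

    asymptotic-bound : AsymptoticBound r (r + d)
    asymptotic-bound = error , error-small , λ ε 0<ε → let e , e≤ε = reciprocal-≤ ε 0<ε in
      suc e ⊔ N e , λ n n≥ → let ws , unique , all , enough = good n (≤-trans (s≤s (s≤s z≤n)) (stage-≥ e n n≥)) in
        ws , unique , All.map (λ h t isMax → long n t (h t isMax)) all ,
        many ε e ((r + d) ^ n) (length ws) (stage n) e≤ε (≤-trans (n≤1+n (suc e)) (stage-≥ e n n≥)) enough

open import Defs
open import Data.Nat as ℕ using (ℕ; _^_)
open import Data.Nat.Properties using (<⇒≤; m+[n∸m]≡n)
open import Data.Rational using (ℚ; _≤_; _<_; _*_; _-_; ∣_∣; 0ℚ; 1ℚ)
open import Data.List using (List; length)
open import Data.List.Relation.Unary.All using (All)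
open import Data.List.Relation.Unary.Unique.Propositional using (Unique)
open import Data.Product using (Σ; _×_; ∃)
open import Relation.Binary.PropositionalEquality using (subst)

theorem1p3 : (r k : ℕ) → 3 ℕ.≤ r → r ℕ.< k →
    Σ (ℕ → ℚ) λ f →
    (∀ ε → 0ℚ < ε → ∃ λ N → ∀ n → N ℕ.≤ n → ∣ f n ∣ ≤ ε * ratio n 1)
    × (∀ ε → 0ℚ < ε → ∃ λ N → ∀ n → N ℕ.≤ n →
    Σ (List (Word k n)) λ ws →
    Unique ws
    × All (λ w → ∀ t → IsMaxTwinLength r w t →
    Π r k * ratio n k - f n ≤ ratio t 1) ws
    × (1ℚ - ε) * ratio (k ^ n) 1 ≤ ratio (length ws) 1)
theorem1p3 (ℕ.suc r₀) k _ r<k = subst (Twinning.AsymptoticBound (ℕ.suc r₀)) (m+[n∸m]≡n (<⇒≤ r<k))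
  (Twinning.Diagonal.asymptotic-bound r₀ (k ℕ.∸ ℕ.suc r₀))
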